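{- Let $n\ge 1$ be an integer, let $q$ be a prime power, let $\mathcal{C}\subseteq \mathrm{U}(n,\mathbb{F}_q)$ be a linear flag-rank-metric code with minimum distance $\delta=7$, and let $\alpha$ be its codimension. Then $\mathcal{C}$ is perfect if and only if $n\ge 3$ satisfies \[ \begin{aligned} &(q-1)^3n^3+3(q-1)^2(2q^2-q+2)n^2\\ &\quad+(q-1)(6q^4-18q^3+26q^2-7q+11)n\\ &\quad+6\bigl(-2q^5+4q^4-5q^3+3q^2+1-q^\alpha\bigr)=0. \end{aligned} \] Moreover, necessarily $\alpha\ge 10$.
   Context: $\mathbb{F}_q$ is the finite field with $q$ elements. $\mathrm{U}(n,\mathbb{F}_q)$ is the $\mathbb{F}_q$-vector space of $n\times n$ upper triangular matrices over $\mathbb{F}_q$; it has dimension $\frac{n(n+1)}{2}$. For $M\in \mathrm{U}(n,\mathbb{F}_q)$ and $1\le i\le n$, $M_{[i]}$ is the $i\times(n-i+1)$ submatrix of $M$ obtained by deleting the first $i-1$ columns and the last $n-i$ rows (i.e. rows $1,\dots,i$ and columns $i,\dots,n$). The flag-rank weight of $M$ is $\mathrm{fr}(M)=\sum_{i=1}^{n}\mathrm{rk}(M_{[i]})$; the flag-rank distance is $\mathrm{d}_{\mathrm{fr}}(A,B)=\mathrm{fr}(A-B)$. A linear flag-rank-metric code is an $\mathbb{F}_q$-subspace $\mathcal{C}$ of $\mathrm{U}(n,\mathbb{F}_q)$; its minimum (flag-rank) distance, defined when $\mathcal{C}\neq\{\boldsymbol{0}\}$, is $\delta=\min\{\mathrm{fr}(M):M\in\mathcal{C}\setminus\{\boldsymbol{0}\}\}$.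 Its codimension is $\frac{n(n+1)}{2}-\dim_{\mathbb{F}_q}(\mathcal{C})$. Let $b_q(n,t)=|\{A\in \mathrm{U}(n,\mathbb{F}_q):\mathrm{fr}(A)\le t\}|$. A code $\mathcal{C}$ with minimum distance $\delta$ is perfect if $|\mathcal{C}|\,b_q(n,t)=q^{\frac{n(n+1)}{2}}$, where $t=\left\lfloor\frac{\delta-1}{2}\right\rfloor$. -}

module Defs where

open import Algebra.Bundles using (CommutativeRing)
open import Algebra.Structures using (IsCommutativeRing)
import Algebra.Properties.CommutativeMonoid.Sum as Sum
open import Data.Fin as Fin using (Fin; toℕ; inject≤; cast; _↑ʳ_)
import Data.Fin.Properties as Fin
open import Data.Fin.Subset using (Subset; Side; inside; outside; _∉_; ∣_∣)
open import Data.Fin.Subset.Properties using (_∈?_)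
open import Data.List as List using (List; []; _∷_; allFin; cartesianProductWith; filter; length)
open import Data.List.Extrema.Nat using (max)
open import Data.List.Membership.Propositional using (_∈_)
open import Data.List.Membership.Propositional.Properties
  using (∈-allFin; ∈-map⁺; ∈-cartesianProductWith⁺)
import Data.List.Relation.Unary.All as All
open import Data.List.Relation.Unary.Any using (here)
open import Data.Nat as ℕ using (ℕ; zero; suc; _∸_; _≤_)
import Data.Nat.DivMod as ℕ
open import Data.Nat.ListAction using (sum)
open import Data.Nat.Primality using (Prime)
import Data.Nat.Properties as ℕ
open import Data.Product using (_×_; _,_; ∃-syntax)
open import Data.Vec as Vec using (Vec; []; _∷_; lookup; tabulate; replicate)
import Data.Vec.Properties as Vec
open import Function using (_↔_; Inverse; _∘_)
open import Function.Properties.Inverse using (↔⇒↣)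
open import Level using (0ℓ)
open import Relation.Binary using (DecidableEquality)
open import Relation.Binary.PropositionalEquality using (_≡_; _≢_; refl; sym; subst)
open import Relation.Nullary using (Dec)
open import Relation.Nullary.Decidable using (map′; _→-dec_; _×-dec_; ¬?; via-injection)
open import Relation.Unary using (Pred; Decidable)

IsPrimePower : ℕ → Set
IsPrimePower q = ∃[ p ] ∃[ k ] (Prime p × 1 ≤ k × q ≡ p ℕ.^ k)

-- The finite field with q elements, up to isomorphism: any model on a set with
-- propositional equality.
record FiniteField (q : ℕ) : Set₁ where
  infixl 7 _*_
  infixl 6 _+_
  infix  8 -_
  field
    Carrier           : Set
    _+_ _*_           : Carrier → Carrier → Carrier
    -_                : Carrier → Carrier
    0# 1#             : Carrier
    isCommutativeRing : IsCommutativeRing _≡_ _+_ _*_ -_ 0# 1#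
    1≢0               : 1# ≢ 0#
    inverse           : ∀ x → x ≢ 0# → ∃[ y ] x * y ≡ 1#
    enumeration       : Carrier ↔ Fin q

  commutativeRing : CommutativeRing 0ℓ 0ℓ
  commutativeRing = record { isCommutativeRing = isCommutativeRing }

  open CommutativeRing commutativeRing public using (+-commutativeMonoid)

  _≟_ : DecidableEquality Carrier
  _≟_ = via-injection (↔⇒↣ enumeration) Fin._≟_

  elements : List Carrier
  elements = List.map (Inverse.from enumeration) (allFin q)

  ∈-elements : ∀ x → x ∈ elements
  ∈-elements x = subst (_∈ elements) (Inverse.strictlyInverseʳ enumeration x)
    (∈-map⁺ (Inverse.from enumeration) (∈-allFin (Inverse.to enumeration x)))

-- All vectors of length n with entries taken from xs.
vectors : ∀ {A : Set} → List A → ∀ n → List (Vec A n)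
vectors xs zero    = [] ∷ []
vectors xs (suc n) = cartesianProductWith _∷_ xs (vectors xs n)

∈-vectors : ∀ {A : Set} {xs : List A} → (∀ x → x ∈ xs) → ∀ {n} (v : Vec A n) → v ∈ vectors xs n
∈-vectors all []      = here refl
∈-vectors all (x ∷ v) = ∈-cartesianProductWith⁺ _∷_ (all x) (∈-vectors all v)

subsets : ∀ n → List (Subset n)
subsets = vectors (inside ∷ outside ∷ [])

module FlagRank {q : ℕ} (F : FiniteField q) where
  open FiniteField F
  open Sum +-commutativeMonoid using () renaming (sum to ∑)

  Matrix : ℕ → ℕ → Set
  Matrix m n = Vec (Vec Carrier n) m

  matrices : ∀ m n → List (Matrix m n)
  matrices m n = vectors (vectors elements n) m

  entry : ∀ {m n} → Matrix m n → Fin m → Fin n → Carrier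
  entry M i j = lookup (lookup M i) j

  mkMatrix : ∀ {m n} → (Fin m → Fin n → Carrier) → Matrix m n
  mkMatrix f = tabulate λ i → tabulate λ j → f i j

  0ᴹ : ∀ {m n} → Matrix m n
  0ᴹ = mkMatrix λ _ _ → 0#

  _+ᴹ_ : ∀ {m n} → Matrix m n → Matrix m n → Matrix m n
  A +ᴹ B = mkMatrix λ i j → entry A i j + entry B i j

  _*ᴹ_ : ∀ {m n} → Carrier → Matrix m n → Matrix m n
  a *ᴹ A = mkMatrix λ i j → a * entry A i j

  linearCombination : ∀ {k m n} → Vec Carrier k → Vec (Matrix m n) k → Matrix m n
  linearCombination c B = mkMatrix λ i j → ∑ λ s → lookup c s * entry (lookup B s) i j

  -- The columns of M with index in S are linearly independent; their
  -- coefficients are the vectors c that vanish outside S.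
  IndependentColumns : ∀ {m n} → Matrix m n → Subset n → Set
  IndependentColumns {m} {n} M S = ∀ (c : Vec Carrier n) →
    (∀ j → j ∉ S → lookup c j ≡ 0#) →
    (∀ i → (∑ λ j → lookup c j * entry M i j) ≡ 0#) →
    ∀ j → lookup c j ≡ 0#

  independentColumns? : ∀ {m n} (M : Matrix m n) → Decidable (IndependentColumns M)
  independentColumns? {m} {n} M S =
    map′ (λ p c → All.lookup p (∈-vectors ∈-elements c)) (λ p → All.tabulate λ {c} _ → p c)
      (All.all? (λ c →
        Fin.all? (λ j → ¬? (j ∈? S) →-dec (lookup c j ≟ 0#)) →-dec
        (Fin.all? (λ i → (∑ λ j → lookup c j * entry M i j) ≟ 0#) →-dec
        Fin.all? (λ j → lookup c j ≟ 0#)))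
        (vectors elements n))

  rank : ∀ {m n} → Matrix m n → ℕ
  rank {n = n} M = max 0 (List.map ∣_∣ (filter (independentColumns? M) (subsets n)))

  UpperTriangular : ∀ {n} → Pred (Matrix n n) 0ℓ
  UpperTriangular {n} M = ∀ (i j : Fin n) → j Fin.< i → entry M i j ≡ 0#

  upperTriangular? : ∀ {n} → Decidable (UpperTriangular {n})
  upperTriangular? M =
    Fin.all? λ i → Fin.all? λ j → (j Fin.<? i) →-dec (entry M i j ≟ 0#)

  -- With i counted from 0, this keeps rows 0, …, i and columns i, …, n - 1;
  -- in 1-based indexing it is the submatrix M_[i+1].
  _[_] : ∀ {n} → Matrix n n → (i : Fin n) → Matrix (suc (toℕ i)) (n ∸ toℕ i)
  M [ i ] = mkMatrix λ r c →
    entry M (inject≤ r (Fin.toℕ<n i))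
            (cast (ℕ.m+[n∸m]≡n (Fin.toℕ≤n i)) (toℕ i ↑ʳ c))

  fr : ∀ {n} → Matrix n n → ℕ
  fr {n} M = sum (List.map (λ i → rank (M [ i ])) (allFin n))

  cardinality : ∀ {m n} {P : Pred (Matrix m n) 0ℓ} → Decidable P → ℕ
  cardinality {m} {n} P? = length (filter P? (matrices m n))

  -- The size of a ball of radius t in U(n, F).
  b : ℕ → ℕ → ℕ
  b n t = cardinality {n} {n} λ A → upperTriangular? A ×-dec (fr A ℕ.≤? t)

  -- Membership is decidable because a code is a subset of a finite set; this
  -- gives access to its number of elements.
  record LinearCode (n : ℕ) : Set₁ where
    field
      Member          : Pred (Matrix n n) 0ℓ
      member?         : Decidable Member
      upperTriangular : ∀ {A} → Member A → UpperTriangular A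
      0-closed        : Member 0ᴹ
      +-closed        : ∀ {A B} → Member A → Member B → Member (A +ᴹ B)
      *-closed        : ∀ a {A} → Member A → Member (a *ᴹ A)

  module _ {n : ℕ} (C : LinearCode n) where
    open LinearCode C

    HasDimension : ℕ → Set
    HasDimension k = ∃[ B ]
      ((∀ (s : Fin k) → Member (lookup B s)) ×
       (∀ (c : Vec Carrier k) → linearCombination c B ≡ 0ᴹ → c ≡ replicate k 0#) ×
       (∀ M → Member M → ∃[ c ] linearCombination c B ≡ M))

    HasCodimension : ℕ → Set
    HasCodimension α = ∃[ k ] (HasDimension k × k ℕ.+ α ≡ (n ℕ.* (n ℕ.+ 1)) ℕ./ 2)

    IsMinimumDistance : ℕ → Set
    IsMinimumDistance δ =
      (∃[ M ] (Member M × M ≢ 0ᴹ × fr M ≡ δ)) ×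
      (∀ M → Member M → M ≢ 0ᴹ → δ ≤ fr M)

    IsPerfect : Set
    IsPerfect = ∃[ δ ] (IsMinimumDistance δ ×
      cardinality member? ℕ.* b n ((δ ∸ 1) ℕ./ 2) ≡ q ℕ.^ ((n ℕ.* (n ℕ.+ 1)) ℕ./ 2))

{-# OPTIONS --safe #-}

-- A matrix has flag-rank weight at most 3 exactly when at most three of the submatrices M_[i]
-- are nonzero and all of them have rank at most 1. Reading off the last nonzero entry of the
-- first row then gives a recursion for the ball sizes, with bₛ(0) = 1:
--   bₛ(n+1) = bₛ(n) + (q-1) bₛ₋₁(n) + q²(q-1) bₛ₋₂(n-1) + q⁴(q-1) bₛ₋₃(n-2),
-- for s ≤ 3, terms with a negative index being 0,
-- whose solution for s = 3 is the cubic of the theorem; since |C| = q^(dim C), perfection says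
-- b₃(n) = q^α. A matrix supported in its first four columns has weight at most 1 + 2 + 2 + 1 = 6,
-- so distance 7 forces n ≥ 5 and makes the projection of C to the remaining columns injective;
-- this loses the 10 upper triangular positions of the first four columns, whence α ≥ 10.

module Submission where

open import Defs
open import Algebra.Bundles using (CommutativeRing)
import Algebra.Properties.CommutativeMonoid.Sum as Sum
import Algebra.Properties.Group as GroupProperties
import Algebra.Properties.Semiring.Sum as SemiringSum
open import Data.Fin as Fin using (Fin; zero; suc; toℕ; punchIn; punchOut; fromℕ<; inject≤; cast; _↑ʳ_)
open import Data.Fin.Patterns using (0F; 1F; 2F; 3F)
import Data.Fin.Properties as Fin
open import Data.Fin.Subset using (Subset; inside; outside; _∉_; ∣_∣; ⁅_⁆; _∪_) renaming (_∈_ to _∈ˢ_)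
import Data.Fin.Subset.Properties as Subset
open import Data.List as List using (List; []; _∷_; _++_; length; allFin; filter; cartesianProduct; cartesianProductWith)
open import Data.List.Extrema.Nat using (max≤v⁺; v≤max⁺)
open import Data.List.Membership.Propositional using (_∈_; lose)
open import Data.List.Membership.Propositional.Properties
import Data.List.Properties as List
open import Data.List.Relation.Binary.Disjoint.Propositional using (Disjoint)
open import Data.List.Relation.Binary.Subset.Propositional using (_⊆_)
import Data.List.Relation.Unary.All as All
import Data.List.Relation.Unary.All.Properties as All
open import Data.List.Relation.Unary.AllPairs using ([]; _∷_)
open import Data.List.Relation.Unary.Any using (here; there)
open import Data.List.Relation.Unary.Unique.Propositional using (Unique)
import Data.List.Relation.Unary.Unique.Propositional.Properties as Unique
open import Data.Nat as ℕ using (ℕ; zero; suc; _∸_; _≤_; _<_; _⊓_; z≤n; s≤s)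
import Data.Nat.DivMod as ℕ
open import Data.Nat.ListAction using (sum)
import Data.Nat.Properties as ℕ
import Data.Nat.Tactic.RingSolver as ℕ-Solver
open import Data.Product using (_×_; _,_; ∃-syntax; proj₁; proj₂)
open import Data.Sum using (_⊎_; inj₁; inj₂)
open import Data.Vec as Vec using (Vec; []; _∷_; lookup; tabulate)
import Data.Vec.Properties as Vec
open import Function using (_∘_; id; Inverse; Injection)
open import Function.Properties.Inverse using (↔⇒↣; ↔-sym)
open import Relation.Binary.PropositionalEquality
  using (_≡_; _≢_; refl; sym; trans; cong; cong₂; subst; subst₂; module ≡-Reasoning)
open import Relation.Nullary using (yes; no; contradiction; ¬?)
open import Relation.Nullary.Decidable using (_×-dec_)

-- Ranks enter only through bounds. Upper bounds come from inclusions of kernels and from counting,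
-- since an injection from F^a to F^b forces a ≤ b. Lower bounds come from a nonzero entry (rank at
-- least 1) or a nonzero 2 × 2 minor (rank at least 2). Within radius 3 nothing finer is needed. Let
-- the last nonzero entry of the first row, the pivot, be in column k. It lies in M_[1], ..., M_[k],
-- so k ≤ 3. For k = 2 or 3 the next rows are almost forced: a nonzero minor of the first two rows
-- inside M_[2] would bring the weight to 1 + 2 + 1, and an entry beyond column k would produce such
-- a minor or a fourth nonzero submatrix. So k rows split off at once, none reaching past column k,
-- and the remaining matrix keeps its own weight. The pivot gives the factor q - 1. The free entries
-- give q² for k = 2 (one in each row) and q⁴ for k = 3 (two, one and one), since the vanishing
-- minor determines one entry of the second row. Every cardinality is the length of a list without
-- duplicates, and two of them are equated by inclusion both ways. The recursion is thus one of
-- lists before it is one of numbers.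

-- Counting: lists without duplicates, finite sums, staircase sizes

unique-⊆⇒length≤ : ∀ {A : Set} {xs ys : List A} → Unique xs → xs ⊆ ys → length xs ≤ length ys
unique-⊆⇒length≤ {xs = []} [] _ = z≤n
unique-⊆⇒length≤ {xs = x ∷ xs} (x∉xs ∷ u) xs⊆ys with ∈-∃++ (xs⊆ys (here refl))
... | as , bs , refl = begin
  suc (length xs)               ≤⟨ s≤s (unique-⊆⇒length≤ u xs⊆as++bs) ⟩
  suc (length (as ++ bs))       ≡⟨ cong suc (List.length-++ as) ⟩
  suc (length as ℕ.+ length bs) ≡⟨ ℕ.+-suc (length as) (length bs) ⟨
  length as ℕ.+ suc (length bs) ≡⟨ List.length-++ as ⟨
  length (as ++ x ∷ bs)         ∎
  where
  open ℕ.≤-Reasoning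
  xs⊆as++bs : xs ⊆ as ++ bs
  xs⊆as++bs y∈xs with ∈-++⁻ as (xs⊆ys (there y∈xs))
  ... | inj₁ y∈as = ∈-++⁺ˡ y∈as
  ... | inj₂ (here refl) = contradiction refl (All.lookup x∉xs y∈xs)
  ... | inj₂ (there y∈bs) = ∈-++⁺ʳ as y∈bs

unique-⊆-⊇⇒length≡ : ∀ {A : Set} {xs ys : List A} →
  Unique xs → Unique ys → xs ⊆ ys → ys ⊆ xs → length xs ≡ length ys
unique-⊆-⊇⇒length≡ u v xs⊆ys ys⊆xs =
  ℕ.≤-antisym (unique-⊆⇒length≤ u xs⊆ys) (unique-⊆⇒length≤ v ys⊆xs)

vectors-unique : ∀ {A : Set} {xs : List A} → Unique xs → ∀ n → Unique (vectors xs n)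
vectors-unique u zero    = All.[] ∷ []
vectors-unique u (suc n) =
  Unique.cartesianProductWith⁺ _∷_ Vec.∷-injective u (vectors-unique u n)

length-cartesianProductWith : ∀ {A B C : Set} (f : A → B → C) xs ys →
  length (cartesianProductWith f xs ys) ≡ length xs ℕ.* length ys
length-cartesianProductWith f []       ys = refl
length-cartesianProductWith f (x ∷ xs) ys = trans (List.length-++ (List.map (f x) ys))
  (cong₂ ℕ._+_ (List.length-map (f x) ys) (length-cartesianProductWith f xs ys))

length-vectors : ∀ {A : Set} (xs : List A) n → length (vectors xs n) ≡ length xs ℕ.^ n
length-vectors xs zero    = refl
length-vectors xs (suc n) = trans (length-cartesianProductWith _∷_ xs (vectors xs n))
  (cong (length xs ℕ.*_) (length-vectors xs n))

lookup-ext : ∀ {A : Set} {n} {u v : Vec A n} → (∀ i → lookup u i ≡ lookup v i) → u ≡ v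
lookup-ext {u = u} {v} eq = trans (sym (Vec.tabulate∘lookup u))
  (trans (Vec.tabulate-cong eq) (Vec.tabulate∘lookup v))

members-below⇒∣S∣≤ : ∀ {n} (S : Subset n) d → (∀ {j} → j ∈ˢ S → toℕ j < d) → ∣ S ∣ ≤ d
members-below⇒∣S∣≤ []            d       _  = z≤n
members-below⇒∣S∣≤ (inside ∷ S)  zero    lt = contradiction (lt Vec.here) ℕ.n≮0
members-below⇒∣S∣≤ (inside ∷ S)  (suc d) lt =
  s≤s (members-below⇒∣S∣≤ S d λ j∈S → ℕ.s<s⁻¹ (lt (Vec.there j∈S)))
members-below⇒∣S∣≤ (outside ∷ S) d       lt =
  members-below⇒∣S∣≤ S d λ j∈S → ℕ.<-trans (ℕ.n<1+n _) (lt (Vec.there j∈S))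

1<order : ∀ {q} → FiniteField q → 1 < q
1<order {0} F = contradiction (Inverse.to enumeration 0#) λ ()
  where open FiniteField F
1<order {1} F = contradiction (Injection.injective (↔⇒↣ enumeration) (Fin1-unique _ _)) 1≢0
  where
  open FiniteField F
  Fin1-unique : (i j : Fin 1) → i ≡ j
  Fin1-unique zero zero = refl
1<order {suc (suc _)} F = s≤s (s≤s z≤n)

-- Tabulating `f` itself makes the sum unfold at `suc n` to `f zero` plus the total of `f ∘ suc`,
-- which is how first rows are later peeled off.
total : ∀ {n} → (Fin n → ℕ) → ℕ
total = sum ∘ List.tabulate

total-mono : ∀ {n} {f g : Fin n → ℕ} → (∀ i → f i ≤ g i) → total f ≤ total g
total-mono {zero}  h = z≤n
total-mono {suc n} h = ℕ.+-mono-≤ (h zero) (total-mono (h ∘ suc))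

total-zero : ∀ {n} {f : Fin n → ℕ} → (∀ i → f i ≡ 0) → total f ≡ 0
total-zero {zero}  h = refl
total-zero {suc n} h = cong₂ ℕ._+_ (h zero) (total-zero (h ∘ suc))

-- The number of positions (i , j) of an (m + d) × d matrix with i ≤ m + j.
stairs : ℕ → ℕ → ℕ
stairs zero    zero    = 0
stairs zero    (suc d) = suc d ℕ.+ stairs zero d
stairs (suc m) d       = d ℕ.+ stairs m d

stairs-double : ∀ n → stairs 0 n ℕ.* 2 ≡ n ℕ.* (n ℕ.+ 1)
stairs-double zero    = refl
stairs-double (suc n) = begin
  (suc n ℕ.+ stairs 0 n) ℕ.* 2      ≡⟨ ℕ.*-distribʳ-+ 2 (suc n) (stairs 0 n) ⟩
  suc n ℕ.* 2 ℕ.+ stairs 0 n ℕ.* 2  ≡⟨ cong (suc n ℕ.* 2 ℕ.+_) (stairs-double n) ⟩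
  suc n ℕ.* 2 ℕ.+ n ℕ.* (n ℕ.+ 1)   ≡⟨ expand n ⟩
  suc n ℕ.* (suc n ℕ.+ 1)           ∎
  where
  open ≡-Reasoning
  expand : ∀ n → suc n ℕ.* 2 ℕ.+ n ℕ.* (n ℕ.+ 1) ≡ suc n ℕ.* (suc n ℕ.+ 1)
  expand = ℕ-Solver.solve-∀

-- `stairs 0 n` is the triangular number n(n+1)/2. Unfolding it four times gives four summands whose
-- excess over `d` is 4, 3, 2 and 1: the 10 positions in the first four columns.
dimension≡10+stairs : ∀ d → ((4 ℕ.+ d) ℕ.* (4 ℕ.+ d ℕ.+ 1)) ℕ./ 2 ≡ 10 ℕ.+ stairs 4 d
dimension≡10+stairs d = begin
  ((4 ℕ.+ d) ℕ.* (4 ℕ.+ d ℕ.+ 1)) ℕ./ 2  ≡⟨ cong (ℕ._/ 2) (stairs-double (4 ℕ.+ d)) ⟨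
  (stairs 0 (4 ℕ.+ d) ℕ.* 2) ℕ./ 2       ≡⟨ ℕ.m*n/n≡m (stairs 0 (4 ℕ.+ d)) 2 ⟩
  stairs 0 (4 ℕ.+ d)                     ≡⟨ expand d (stairs 0 d) ⟩
  10 ℕ.+ stairs 4 d                      ∎
  where
  open ≡-Reasoning
  expand : ∀ d t → (4 ℕ.+ d) ℕ.+ ((3 ℕ.+ d) ℕ.+ ((2 ℕ.+ d) ℕ.+ ((1 ℕ.+ d) ℕ.+ t))) ≡
    10 ℕ.+ (d ℕ.+ (d ℕ.+ (d ℕ.+ (d ℕ.+ t))))
  expand = ℕ-Solver.solve-∀

-- Vectors, matrices and sums over the field

module Balls {q : ℕ} (F : FiniteField q) where
  open FiniteField F
  open FlagRank F
  open CommutativeRing commutativeRing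
    using ( +-identityˡ; +-identityʳ; +-assoc; +-comm; -‿inverseˡ; -‿inverseʳ
          ; *-identityˡ; *-identityʳ; *-assoc; *-comm; zeroˡ; zeroʳ; distribˡ; distribʳ; +-group; semiring)
  open Sum +-commutativeMonoid using
    (∑-distrib-+; sum-cong-≗; sum-remove; sum-replicate-zero) renaming (sum to ∑)
  open SemiringSum semiring using () renaming (*-distribˡ-sum to *-distribˡ-∑)
  open GroupProperties +-group using () renaming (∙-cancelʳ to +-cancelʳ)

  elements-unique : Unique elements
  elements-unique =
    Unique.map⁺ (Injection.injective (↔⇒↣ (↔-sym enumeration))) (Unique.allFin⁺ q)

  length-elements : length elements ≡ q
  length-elements = trans (List.length-map _ (allFin q)) (List.length-tabulate id)

  -- Pigeonhole on q^a and q^b with q > 1. It stands in for dimension theory, both for the rank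
  -- bound by rows and for the bound on the dimension of the code.
  vec-injection⇒≤ : ∀ {a b} (f : Vec Carrier a → Vec Carrier b) →
    (∀ {u v} → f u ≡ f v → u ≡ v) → a ≤ b
  vec-injection⇒≤ {a} {b} f inj with a ℕ.≤? b
  ... | yes a≤b = a≤b
  ... | no  a≰b = contradiction
    (ℕ.≤-trans (ℕ.≤-reflexive (sym (size a))) (ℕ.≤-trans
      (subst (_≤ length (vectors elements b)) (List.length-map f (vectors elements a))
        (unique-⊆⇒length≤ (Unique.map⁺ inj
          (vectors-unique elements-unique a)) λ _ → ∈-vectors ∈-elements _))
      (ℕ.≤-reflexive (size b))))
    (ℕ.<⇒≱ (ℕ.^-monoʳ-< q (1<order F) (ℕ.≰⇒> a≰b)))
    where
    size : ∀ n → length (vectors elements n) ≡ q ℕ.^ n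
    size n = trans (length-vectors elements n) (cong (ℕ._^ n) length-elements)

  infix 8 _⁻¹
  -- Made total by sending 0 to 0, so that `extend₃` can divide by its pivot without carrying a
  -- proof that the pivot is nonzero.
  _⁻¹ : Carrier → Carrier
  x ⁻¹ with x ≟ 0#
  ... | yes _   = 0#
  ... | no  x≢0 = proj₁ (inverse x x≢0)

  ⁻¹-inverseˡ : ∀ {x} → x ≢ 0# → x ⁻¹ * x ≡ 1#
  ⁻¹-inverseˡ {x} x≢0 with x ≟ 0#
  ... | yes x≡0  = contradiction x≡0 x≢0
  ... | no  x≢0′ = trans (*-comm _ x) (proj₂ (inverse x x≢0′))

  /-cancel : ∀ y {x} → x ≢ 0# → y * x ⁻¹ * x ≡ y
  /-cancel y {x} x≢0 =
    trans (*-assoc y (x ⁻¹) x) (trans (cong (y *_) (⁻¹-inverseˡ x≢0)) (*-identityʳ y))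

  *-cancelˡ : ∀ {x y z} → x ≢ 0# → x * y ≡ x * z → y ≡ z
  *-cancelˡ {x} {y} {z} x≢0 eq = trans (sym (undo y)) (trans (cong (x ⁻¹ *_) eq) (undo z))
    where
    undo : ∀ w → x ⁻¹ * (x * w) ≡ w
    undo w = trans (sym (*-assoc (x ⁻¹) x w))
      (trans (cong (_* w) (⁻¹-inverseˡ x≢0)) (*-identityˡ w))

  *-swap : ∀ x y z → x * (y * z) ≡ y * (x * z)
  *-swap x y z = trans (sym (*-assoc x y z)) (trans (cong (_* z) (*-comm x y)) (*-assoc y x z))

  entry-mkMatrix : ∀ {m n} (f : Fin m → Fin n → Carrier) i j → entry (mkMatrix f) i j ≡ f i j
  entry-mkMatrix f i j =
    trans (cong (λ r → lookup r j) (Vec.lookup∘tabulate _ i)) (Vec.lookup∘tabulate _ j)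

  matrix-ext : ∀ {m n} {A B : Matrix m n} → (∀ i j → entry A i j ≡ entry B i j) → A ≡ B
  matrix-ext eq = lookup-ext λ i → lookup-ext (eq i)

  ∑-zero : ∀ {n} {f : Fin n → Carrier} → (∀ j → f j ≡ 0#) → ∑ f ≡ 0#
  ∑-zero {n} h = trans (sum-cong-≗ h) (sum-replicate-zero n)

  ∑-single : ∀ {n} (f : Fin n → Carrier) j → (∀ k → k ≢ j → f k ≡ 0#) → ∑ f ≡ f j
  ∑-single {suc n} f j h = trans (sum-remove {i = j} f)
    (trans (cong (f j +_) (∑-zero λ k → h _ (Fin.punchInᵢ≢i j k))) (+-identityʳ _))

  ∑-pair : ∀ {n} (f : Fin n → Carrier) {j j′} → j ≢ j′ →
    (∀ k → k ≢ j → k ≢ j′ → f k ≡ 0#) → ∑ f ≡ f j + f j′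
  ∑-pair {suc n} f {j} {j′} j≢j′ h = trans (sum-remove {i = j} f) (cong (f j +_)
    (trans (∑-single (f ∘ punchIn j) (punchOut j≢j′) λ k k≢ →
      h _ (Fin.punchInᵢ≢i j k) λ eq →
        k≢ (Fin.punchIn-injective j k _ (trans eq (sym (Fin.punchIn-punchOut j≢j′)))))
      (cong f (Fin.punchIn-punchOut j≢j′))))

  _-ⱽ_ : ∀ {n} → Vec Carrier n → Vec Carrier n → Vec Carrier n
  _-ⱽ_ = Vec.zipWith λ x y → x + - y

  minus-plus : ∀ x y → x + - y + y ≡ x
  minus-plus x y = trans (+-assoc x (- y) y) (trans (cong (x +_) (-‿inverseˡ y)) (+-identityʳ x))

  minus≡0⇒≡ : ∀ {x y} → x + - y ≡ 0# → x ≡ y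
  minus≡0⇒≡ {x} {y} eq = trans (sym (minus-plus x y)) (trans (cong (_+ y) eq) (+-identityˡ y))

  -ⱽ≡0⇒≡ : ∀ {n} {u v : Vec Carrier n} → (∀ i → lookup (u -ⱽ v) i ≡ 0#) → u ≡ v
  -ⱽ≡0⇒≡ {u = u} {v} h = lookup-ext λ i → minus≡0⇒≡ (trans (sym (Vec.lookup-zipWith _ i u v)) (h i))

  -- The subtrahend is added back, so that negation never has to move through products and sums;
  -- cancellation then yields the difference.
  ∑-minus : ∀ {n} (u v : Vec Carrier n) (a : Fin n → Carrier) →
    ∑ (λ j → lookup (u -ⱽ v) j * a j) + ∑ (λ j → lookup v j * a j) ≡ ∑ (λ j → lookup u j * a j)
  ∑-minus u v a = trans
    (sym (∑-distrib-+ (λ j → lookup (u -ⱽ v) j * a j) (λ j → lookup v j * a j)))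
      (sum-cong-≗ λ j → begin
    lookup (u -ⱽ v) j * a j + lookup v j * a j   ≡⟨ distribʳ (a j) _ _ ⟨
    (lookup (u -ⱽ v) j + lookup v j) * a j
      ≡⟨ cong (λ x → (x + lookup v j) * a j) (Vec.lookup-zipWith _ j u v) ⟩
    (lookup u j + - lookup v j + lookup v j) * a j ≡⟨ cong (_* a j) (minus-plus _ _) ⟩
    lookup u j * a j                             ∎)
    where open ≡-Reasoning

  ∑-minus≡0 : ∀ {n} (u v : Vec Carrier n) (a : Fin n → Carrier) →
    ∑ (λ j → lookup u j * a j) ≡ ∑ (λ j → lookup v j * a j) → ∑ (λ j → lookup (u -ⱽ v) j * a j) ≡ 0#
  ∑-minus≡0 u v a eq = +-cancelʳ _ _ _ (trans (∑-minus u v a) (trans eq (sym (+-identityˡ _))))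

  -- Bounds on the rank

  module _ {m n : ℕ} (A : Matrix m n) where
    Kills : Vec Carrier n → Set
    Kills c = ∀ i → ∑ (λ j → lookup c j * entry A i j) ≡ 0#

    rank≤ : ∀ {d} → (∀ S → IndependentColumns A S → ∣ S ∣ ≤ d) → rank A ≤ d
    rank≤ h = max≤v⁺ z≤n
      (All.map⁺ (All.map (h _) (All.all-filter (independentColumns? A) (subsets n))))

    ≤rank : ∀ S → IndependentColumns A S → ∣ S ∣ ≤ rank A
    ≤rank S ind = v≤max⁺ 0 _ (inj₂ (lose (∈-map⁺ ∣_∣
      (∈-filter⁺ (independentColumns? A) (∈-vectors side∈ S) ind)) ℕ.≤-refl))
      where
      side∈ : ∀ s → s ∈ (inside ∷ outside ∷ [])
      side∈ inside  = here refl
      side∈ outside = there (here refl)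

  -- A larger kernel admits fewer independent column sets: a set independent for `A` stays
  -- independent for `B`. The numbers of rows may differ, so this compares matrices before and after
  -- a row is removed.
  rank-mono : ∀ {m m′ n} (A : Matrix m n) (B : Matrix m′ n) →
    (∀ c → Kills B c → Kills A c) → rank A ≤ rank B
  rank-mono A B h = rank≤ A λ S ind → ≤rank B S λ c off kills → ind c off (h c kills)

  spread : ∀ {n} (S : Subset n) → Vec Carrier ∣ S ∣ → Vec Carrier n
  spread []            []      = []
  spread (inside ∷ S)  (x ∷ v) = x ∷ spread S v
  spread (outside ∷ S) v       = 0# ∷ spread S v

  spread-injective : ∀ {n} (S : Subset n) {u v} → spread S u ≡ spread S v → u ≡ v
  spread-injective [] {[]} {[]} _ = refl
  spread-injective (inside ∷ S) {x ∷ u} {y ∷ v} eq =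
    cong₂ _∷_ (Vec.∷-injectiveˡ eq) (spread-injective S (Vec.∷-injectiveʳ eq))
  spread-injective (outside ∷ S) eq = spread-injective S (Vec.∷-injectiveʳ eq)

  spread-∉ : ∀ {n} (S : Subset n) v j → j ∉ S → lookup (spread S v) j ≡ 0#
  spread-∉ (inside ∷ S)  (x ∷ v) zero    j∉S = contradiction Vec.here j∉S
  spread-∉ (inside ∷ S)  (x ∷ v) (suc j) j∉S = spread-∉ S v j (j∉S ∘ Vec.there)
  spread-∉ (outside ∷ S) v       zero    j∉S = refl
  spread-∉ (outside ∷ S) v       (suc j) j∉S = spread-∉ S v j (j∉S ∘ Vec.there)

  -- An independent set S of columns makes v ↦ A (spread S v) an injection F^∣S∣ → F^m.
  rank≤rows : ∀ {m n} (A : Matrix m n) → rank A ≤ m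
  rank≤rows A = rank≤ A λ S ind → vec-injection⇒≤ (image S) λ {u} {v} eq →
    spread-injective S (-ⱽ≡0⇒≡ (ind (spread S u -ⱽ spread S v)
      (λ j j∉S → trans (Vec.lookup-zipWith _ j (spread S u) (spread S v))
        (trans (cong₂ (λ x y → x + - y) (spread-∉ S u j j∉S) (spread-∉ S v j j∉S)) (-‿inverseʳ 0#)))
      (λ i → ∑-minus≡0 (spread S u) (spread S v) (entry A i)
        (trans (sym (Vec.lookup∘tabulate _ i))
          (trans (cong (λ w → lookup w i) eq) (Vec.lookup∘tabulate _ i))))))
    where
    image : ∀ S → Vec Carrier ∣ S ∣ → Vec Carrier _
    image S v = tabulate λ i → ∑ λ j → lookup (spread S v) j * entry A i j

  unit : ∀ {n} → Fin n → Vec Carrier n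
  unit j = Vec.replicate _ 0# Vec.[ j ]≔ 1#

  lookup-unit-≡ : ∀ {n} (j : Fin n) → lookup (unit j) j ≡ 1#
  lookup-unit-≡ j = Vec.lookup∘update j (Vec.replicate _ 0#) 1#

  lookup-unit-≢ : ∀ {n} {j k : Fin n} → k ≢ j → lookup (unit j) k ≡ 0#
  lookup-unit-≢ {j = j} {k} k≢j =
    trans (Vec.lookup∘update′ k≢j (Vec.replicate _ 0#) 1#) (Vec.lookup-replicate k 0#)

  -- The unit vector of a zero column is a nontrivial relation, so an independent set contains no
  -- index from `d` on.
  rank≤columns : ∀ {m n} (A : Matrix m n) d → (∀ i j → d ≤ toℕ j → entry A i j ≡ 0#) → rank A ≤ d
  rank≤columns A d zeros = rank≤ A λ S ind → members-below⇒∣S∣≤ S d λ {j} j∈S → below S ind j∈S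
    where
    below : ∀ S → IndependentColumns A S → ∀ {j} → j ∈ˢ S → toℕ j < d
    below S ind {j} j∈S with toℕ j ℕ.<? d
    ... | yes j<d = j<d
    ... | no  j≮d = contradiction
      (trans (sym (lookup-unit-≡ j)) (ind (unit j)
        (λ k k∉S → lookup-unit-≢ {j = j} λ { refl → k∉S j∈S })
        (λ i → ∑-zero (vanish i)) j)) 1≢0
      where
      vanish : ∀ i k → lookup (unit j) k * entry A i k ≡ 0#
      vanish i k with k Fin.≟ j
      ... | yes refl = trans (cong (_ *_) (zeros i j (ℕ.≮⇒≥ j≮d))) (zeroʳ _)
      ... | no  k≢j = trans (cong (_* _) (lookup-unit-≢ k≢j)) (zeroˡ _)

  nonzero⇒1≤rank : ∀ {m n} (A : Matrix m n) i j → entry A i j ≢ 0# → 1 ≤ rank A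
  nonzero⇒1≤rank A i j a≢0 = subst (_≤ rank A) (Subset.∣⁅x⁆∣≡1 j) (≤rank A ⁅ j ⁆ ind)
    where
    ind : IndependentColumns A ⁅ j ⁆
    ind c off kills k with k Fin.≟ j
    ... | no  k≢j  = off k (k≢j ∘ Subset.x∈⁅y⁆⇒x≡y j)
    ... | yes refl = *-cancelˡ a≢0 (trans (*-comm _ _) (trans
      (sym (∑-single _ j λ k k≢j → trans (cong (_* _) (off k (k≢j ∘ Subset.x∈⁅y⁆⇒x≡y j)))
        (zeroˡ _)))
      (trans (kills i) (sym (zeroʳ _)))))

  -- A relation between columns `j` and `j′` restricts to two equations in two unknowns, one for
  -- each of the rows `i` and `i′`. Eliminating one unknown while the other is nonzero makes the
  -- minor vanish.
  minor⇒2≤rank : ∀ {m n} (A : Matrix m n) i i′ {j j′} → j ≢ j′ →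
    entry A i j * entry A i′ j′ ≢ entry A i j′ * entry A i′ j → 2 ≤ rank A
  minor⇒2≤rank A i i′ {j} {j′} j≢j′ minor = ℕ.≤-trans 2≤∣S∣ (≤rank A S ind)
    where
    S = ⁅ j ⁆ ∪ ⁅ j′ ⁆
    j∈S : j ∈ˢ S
    j∈S = Subset.x∈p∪q⁺ (inj₁ (Subset.x∈⁅x⁆ j))
    j′∈S : j′ ∈ˢ S
    j′∈S = Subset.x∈p∪q⁺ (inj₂ (Subset.x∈⁅x⁆ j′))
    S⊆ : ∀ {k} → k ≢ j → k ≢ j′ → k ∉ S
    S⊆ k≢j k≢j′ k∈S with Subset.x∈p∪q⁻ ⁅ j ⁆ ⁅ j′ ⁆ k∈S
    ... | inj₁ k∈ = k≢j (Subset.x∈⁅y⁆⇒x≡y j k∈)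
    ... | inj₂ k∈ = k≢j′ (Subset.x∈⁅y⁆⇒x≡y j′ k∈)
    2≤∣S∣ : 2 ≤ ∣ S ∣
    -- Removing `j` and then `j′` lowers the size strictly twice.
    2≤∣S∣ = ℕ.≤-trans (s≤s (ℕ.≤-trans (s≤s z≤n) (Subset.x∈p⇒∣p-x∣<∣p∣
      (Subset.x∈p∧x≢y⇒x∈p-y j′∈S (j≢j′ ∘ sym))))) (Subset.x∈p⇒∣p-x∣<∣p∣ j∈S)
    ind : IndependentColumns A S
    ind c off kills = only
      where
      x = lookup c j
      y = lookup c j′
      equation : ∀ i → x * entry A i j + y * entry A i j′ ≡ 0#
      equation i = trans (sym (∑-pair _ j≢j′ λ k k≢j k≢j′ →
        trans (cong (_* _) (off k (S⊆ k≢j k≢j′))) (zeroˡ _))) (kills i)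
      proportional : ∀ x y {a a′ b b′} →
        x * a + y * a′ ≡ 0# → x * b + y * b′ ≡ 0# → x ≢ 0# → a * b′ ≡ a′ * b
      proportional x y {a} {a′} {b} {b′} eq₁ eq₂ x≢0 =
        -- After `y * (a′ * b′)` is added, the two sides become `b′` times the first equation and
        -- `a′` times the second, so both are 0.
        *-cancelˡ x≢0 (+-cancelʳ (y * (a′ * b′)) _ _ (begin
        x * (a * b′) + y * (a′ * b′)   ≡⟨ cong₂ _+_ (*-assoc x a b′) (*-assoc y a′ b′) ⟨
        x * a * b′ + y * a′ * b′       ≡⟨ distribʳ b′ _ _ ⟨
        (x * a + y * a′) * b′          ≡⟨ cong (_* b′) eq₁ ⟩
        0# * b′                        ≡⟨ zeroˡ b′ ⟩
        0#                             ≡⟨ zeroʳ a′ ⟨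
        a′ * 0#                        ≡⟨ cong (a′ *_) eq₂ ⟨
        a′ * (x * b + y * b′)          ≡⟨ distribˡ a′ _ _ ⟩
        a′ * (x * b) + a′ * (y * b′)   ≡⟨ cong₂ _+_ (*-swap a′ x b) (*-swap a′ y b′) ⟩
        x * (a′ * b) + y * (a′ * b′)   ∎))
        where open ≡-Reasoning
      x≡0 : x ≡ 0#
      x≡0 with x ≟ 0#
      ... | yes eq = eq
      ... | no x≢0 = contradiction (proportional x y (equation i) (equation i′) x≢0) minor
      y≡0 : y ≡ 0#
      y≡0 with y ≟ 0#
      ... | yes eq = eq
      ... | no y≢0 = contradiction
        (sym (proportional y x (trans (+-comm _ _) (equation i))
          (trans (+-comm _ _) (equation i′)) y≢0)) minor
      only : ∀ k → lookup c k ≡ 0#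
      only k with k Fin.≟ j | k Fin.≟ j′
      ... | yes refl | _        = x≡0
      ... | no _     | yes refl = y≡0
      ... | no k≢j   | no k≢j′  = off k (S⊆ k≢j k≢j′)

  -- subrank and weight only hide rank and fr, whose unfolding in goals is prohibitively slow.
  opaque
    subrank : ∀ {n} → Matrix n n → Fin n → ℕ
    subrank M i = rank (M [ i ])

    weight : ∀ {n} → Matrix n n → ℕ
    weight = fr

    weight≡fr : ∀ {n} (M : Matrix n n) → weight M ≡ fr M
    weight≡fr M = refl

    weight≡total : ∀ {n} (M : Matrix n n) → weight M ≡ total (subrank M)
    weight≡total M = cong sum (List.map-tabulate id (subrank M))

    subrank≤rows : ∀ {n} (M : Matrix n n) i → subrank M i ≤ suc (toℕ i)
    subrank≤rows M i = rank≤rows (M [ i ])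

  -- Every row is a multiple of `w`, so the kernel contains that of the one-row matrix `w`, whose
  -- rank is at most its number of rows.
  rank-proportional : ∀ {m n} (A : Matrix m n) (l : Fin m → Carrier) (w : Fin n → Carrier) →
    (∀ i j → entry A i j ≡ l i * w j) → rank A ≤ 1
  rank-proportional A l w eq = ℕ.≤-trans (rank-mono A B kills) (rank≤rows B)
    where
    B : Matrix 1 _
    B = mkMatrix λ _ → w
    kills : ∀ c → Kills B c → Kills A c
    kills c Bc≡0 i = trans
      (sum-cong-≗ λ j → trans
        (cong (_ *_) (trans (eq i j)
          (cong (l i *_) (sym (entry-mkMatrix (λ _ → w) (zero {0}) j))))) (*-swap _ _ _))
      (trans (sym (*-distribˡ-∑ (l i) λ j → lookup c j * entry B zero j))
        (trans (cong (l i *_) (Bc≡0 zero)) (zeroʳ _)))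

  -- Entries and ranks of the submatrices M_[i], expressed through M

  column : ∀ {n} (i : Fin n) → Fin (n ∸ toℕ i) → Fin n
  column i c = cast (ℕ.m+[n∸m]≡n (Fin.toℕ≤n i)) (toℕ i ↑ʳ c)

  entry-sub : ∀ {n} (M : Matrix n n) i r c →
    entry (M [ i ]) r c ≡ entry M (inject≤ r (Fin.toℕ<n i)) (column i c)
  entry-sub M i r c = entry-mkMatrix (λ r c → entry M (inject≤ r (Fin.toℕ<n i)) (column i c)) r c

  toℕ-column : ∀ {n} (i : Fin n) c → toℕ (column i c) ≡ toℕ i ℕ.+ toℕ c
  toℕ-column i c = trans (Fin.toℕ-cast _ (toℕ i ↑ʳ c)) (Fin.toℕ-↑ʳ (toℕ i) c)

  rowIndex : ∀ {n} {i r : Fin n} → r Fin.≤ i → Fin (suc (toℕ i))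
  rowIndex r≤i = fromℕ< (s≤s r≤i)

  columnIndex : ∀ {n} {i c : Fin n} → i Fin.≤ c → Fin (n ∸ toℕ i)
  columnIndex {c = c} i≤c = fromℕ< (ℕ.∸-monoˡ-< (Fin.toℕ<n c) i≤c)

  inject-rowIndex : ∀ {n} {i r : Fin n} (r≤i : r Fin.≤ i) → inject≤ (rowIndex r≤i) (Fin.toℕ<n i) ≡ r
  inject-rowIndex r≤i = Fin.toℕ-injective
    (trans (Fin.toℕ-inject≤ (rowIndex r≤i) _) (Fin.toℕ-fromℕ< (s≤s r≤i)))

  column-columnIndex : ∀ {n} {i c : Fin n} (i≤c : i Fin.≤ c) → column i (columnIndex i≤c) ≡ c
  column-columnIndex {i = i} {c} i≤c = Fin.toℕ-injective (trans (toℕ-column i _)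
    (trans (cong (toℕ i ℕ.+_) (Fin.toℕ-fromℕ< (ℕ.∸-monoˡ-< (Fin.toℕ<n c) i≤c))) (ℕ.m+[n∸m]≡n i≤c)))

  entry-sub-index : ∀ {n} (M : Matrix n n) {i r c : Fin n} (r≤i : r Fin.≤ i) (i≤c : i Fin.≤ c) →
    entry (M [ i ]) (rowIndex r≤i) (columnIndex i≤c) ≡ entry M r c
  entry-sub-index M {i} r≤i i≤c = trans (entry-sub M i (rowIndex r≤i) (columnIndex i≤c))
    (cong₂ (entry M) (inject-rowIndex r≤i) (column-columnIndex i≤c))

  opaque
    unfolding subrank
    nonzero⇒1≤subrank : ∀ {n} (M : Matrix n n) {i r c : Fin n} → r Fin.≤ i → i Fin.≤ c →
      entry M r c ≢ 0# → 1 ≤ subrank M i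
    nonzero⇒1≤subrank M r≤i i≤c ≢0 =
      nonzero⇒1≤rank (M [ _ ]) (rowIndex r≤i) (columnIndex i≤c)
        (≢0 ∘ trans (sym (entry-sub-index M r≤i i≤c)))

    minor⇒2≤subrank : ∀ {n} (M : Matrix n n) {i r r′ c c′ : Fin n} →
      r Fin.≤ i → r′ Fin.≤ i → i Fin.≤ c → i Fin.≤ c′ → c ≢ c′ →
      entry M r c * entry M r′ c′ ≢ entry M r c′ * entry M r′ c → 2 ≤ subrank M i
    minor⇒2≤subrank M {i} r≤i r′≤i i≤c i≤c′ c≢c′ minor =
      minor⇒2≤rank (M [ i ]) (rowIndex r≤i) (rowIndex r′≤i)
        (λ eq → c≢c′ (trans (sym (column-columnIndex i≤c))
          (trans (cong (column i) eq) (column-columnIndex i≤c′))))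
        (λ eq → minor (trans
          (sym (cong₂ _*_ (entry-sub-index M r≤i i≤c) (entry-sub-index M r′≤i i≤c′)))
          (trans eq (cong₂ _*_ (entry-sub-index M r≤i i≤c′) (entry-sub-index M r′≤i i≤c)))))

  inject-≤ : ∀ {n} (i : Fin n) (r : Fin (suc (toℕ i))) → inject≤ r (Fin.toℕ<n i) Fin.≤ i
  inject-≤ i r = subst (_≤ toℕ i) (sym (Fin.toℕ-inject≤ r _)) (ℕ.s≤s⁻¹ (Fin.toℕ<n r))

  opaque
    unfolding subrank
    subrank≤columns : ∀ {n} (M : Matrix n n) (i : Fin n) d →
      (∀ r c → r Fin.≤ i → toℕ i ℕ.+ d ≤ toℕ c → entry M r c ≡ 0#) → subrank M i ≤ d
    subrank≤columns M i d zeros = rank≤columns (M [ i ]) d λ r c d≤c →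
      trans (entry-sub M i r c) (zeros _ _ (inject-≤ i r)
        (subst (toℕ i ℕ.+ d ≤_) (sym (toℕ-column i c)) (ℕ.+-monoʳ-≤ (toℕ i) d≤c)))

    subrank-proportional : ∀ {n} (M : Matrix n n) (i : Fin n) (l w : Fin n → Carrier) →
      (∀ r c → r Fin.≤ i → i Fin.≤ c → entry M r c ≡ l r * w c) → subrank M i ≤ 1
    subrank-proportional M i l w eq = rank-proportional (M [ i ])
      (λ r → l (inject≤ r (Fin.toℕ<n i))) (w ∘ column i)
      λ r c → trans (entry-sub M i r c) (eq _ _ (inject-≤ i r)
        (subst (toℕ i ≤_) (sym (toℕ-column i c)) (ℕ.m≤m+n _ _)))

  -- Upper triangular matrices built row by row

  zeros : ∀ {n} → Vec Carrier n
  zeros = Vec.replicate _ 0#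

  lookup-zeros : ∀ {n} (j : Fin n) → lookup zeros j ≡ 0#
  lookup-zeros j = Vec.lookup-replicate j 0#

  zeros? : ∀ {n} (v : Vec Carrier n) → v ≡ zeros ⊎ (∃[ j ] lookup v j ≢ 0#)
  zeros? [] = inj₁ refl
  zeros? (x ∷ v) with x ≟ 0# | zeros? v
  ... | no x≢0   | _               = inj₂ (zero , x≢0)
  ... | yes refl | inj₁ refl       = inj₁ refl
  ... | yes refl | inj₂ (j , vj≢0) = inj₂ (suc j , vj≢0)

  infixr 5 _∷ᵁ_
  -- Puts a row on top and a zero column to the left. Every nonempty upper triangular matrix arises
  -- in this way from exactly one row and one smaller upper triangular matrix.
  _∷ᵁ_ : ∀ {n} → Vec Carrier (suc n) → Matrix n n → Matrix (suc n) (suc n)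
  r ∷ᵁ M = r ∷ Vec.map (0# ∷_) M

  entry-suc : ∀ {n} (r : Vec Carrier (suc n)) (M : Matrix n n) i j →
    entry (r ∷ᵁ M) (suc i) (suc j) ≡ entry M i j
  entry-suc r M i j = cong (λ v → lookup v (suc j)) (Vec.lookup-map i (0# ∷_) M)

  ∷ᵁ-injective : ∀ {n} {r r′ : Vec Carrier (suc n)} {M M′ : Matrix n n} →
    r ∷ᵁ M ≡ r′ ∷ᵁ M′ → r ≡ r′ × M ≡ M′
  ∷ᵁ-injective {r = r} {r′} {M} {M′} eq = Vec.∷-injectiveˡ eq , matrix-ext λ i j →
    trans (sym (entry-suc r M i j))
      (trans (cong (λ A → entry A (suc i) (suc j)) eq) (entry-suc r′ M′ i j))

  upperTriangular-∷ᵁ : ∀ {n} (r : Vec Carrier (suc n)) {M : Matrix n n} → UpperTriangular M →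
    UpperTriangular (r ∷ᵁ M)
  upperTriangular-∷ᵁ r {M} ut (suc i) zero    _   =
    cong (λ v → lookup v zero) (Vec.lookup-map i (0# ∷_) M)
  upperTriangular-∷ᵁ r {M} ut (suc i) (suc j) j<i = trans (entry-suc r M i j) (ut i j (ℕ.s<s⁻¹ j<i))

  upperTriangular-∷ᵁ⁻¹ : ∀ {n} (A : Matrix (suc n) (suc n)) → UpperTriangular A →
    ∃[ r ] ∃[ M ] (UpperTriangular M × A ≡ r ∷ᵁ M)
  upperTriangular-∷ᵁ⁻¹ {n} A@(r ∷ R) ut = r , M , utM , A≡
    where
    M = Vec.map Vec.tail R
    A≡ : r ∷ R ≡ r ∷ᵁ M
    A≡ = cong (r ∷_) (trans (sym (Vec.map-id R))
      (trans (lookup-ext step) (Vec.map-∘ (0# ∷_) Vec.tail R)))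
      where
      η : (v : Vec Carrier (suc n)) → lookup v zero ≡ 0# → v ≡ 0# ∷ Vec.tail v
      η (x ∷ v) refl = refl
      step : ∀ i → lookup (Vec.map id R) i ≡ lookup (Vec.map (λ v → 0# ∷ Vec.tail v) R) i
      step i = trans (Vec.lookup-map i id R)
        (trans (η (lookup R i) (ut (suc i) zero (s≤s z≤n))) (sym (Vec.lookup-map i _ R)))
    utM : UpperTriangular M
    utM i j j<i = trans (sym (entry-suc r M i j))
      (trans (cong (λ B → entry B (suc i) (suc j)) (sym A≡)) (ut (suc i) (suc j) (s≤s j<i)))

  opaque
    unfolding subrank
    -- Without its first row, the submatrix of `r ∷ᵁ M` at `suc i` is the submatrix of `M` at `i`;
    -- dropping a row can only enlarge the kernel.
    subrank-tail≤ : ∀ {n} (r : Vec Carrier (suc n)) (M : Matrix n n) i →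
      subrank M i ≤ subrank (r ∷ᵁ M) (suc i)
    subrank-tail≤ r M i = rank-mono (M [ i ]) ((r ∷ᵁ M) [ suc i ]) λ c kills k → trans
      (sum-cong-≗ λ j → cong (lookup c j *_)
        (trans (entry-sub M i k j) (trans (sym (entry-suc r M _ (column i j)))
        (sym (entry-sub (r ∷ᵁ M) (suc i) (suc k) j)))))
      (kills (suc k))

    -- The additional row is zero in all columns of the submatrix, so it imposes no condition on the
    -- kernel.
    subrank≤tail : ∀ {n} (r : Vec Carrier (suc n)) (M : Matrix n n) i →
      (∀ c → i Fin.< c → lookup r c ≡ 0#) → subrank (r ∷ᵁ M) (suc i) ≤ subrank M i
    subrank≤tail r M i r≡0 = rank-mono ((r ∷ᵁ M) [ suc i ]) (M [ i ]) kills
      where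
      kills : ∀ c → Kills (M [ i ]) c → Kills ((r ∷ᵁ M) [ suc i ]) c
      kills c _ zero = ∑-zero λ j → trans
        (cong (lookup c j *_) (trans (entry-sub (r ∷ᵁ M) (suc i) zero j)
        (r≡0 (suc (column i j))
          (s≤s (subst (toℕ i ≤_) (sym (toℕ-column i j)) (ℕ.m≤m+n _ _)))))) (zeroʳ _)
      kills c Mc≡0 (suc k) = trans (sum-cong-≗ λ j → cong (lookup c j *_)
        (trans (entry-sub (r ∷ᵁ M) (suc i) (suc k) j)
          (trans (entry-suc r M _ (column i j)) (sym (entry-sub M i k j)))))
        (Mc≡0 k)

  -- The weight after one, two or three rows are split off

  weight-peel¹-≥ : ∀ {n} (A : Matrix (1 ℕ.+ n) (1 ℕ.+ n)) (M : Matrix n n) →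
    (∀ i → subrank M i ≤ subrank A (suc i)) →
    subrank A 0F ℕ.+ weight M ≤ weight A
  weight-peel¹-≥ A M h = begin
    subrank A 0F ℕ.+ weight M
      ≡⟨ cong (λ x → subrank A 0F ℕ.+ x) (weight≡total M) ⟩
    subrank A 0F ℕ.+ total (λ i → subrank M i)
      ≤⟨ ℕ.+-monoʳ-≤ (subrank A 0F) (total-mono h) ⟩
    subrank A 0F ℕ.+ total (λ i → subrank A (suc i))
      ≡⟨ weight≡total A ⟨
    weight A ∎
    where open ℕ.≤-Reasoning

  weight-peel¹-≤ : ∀ {n} (A : Matrix (1 ℕ.+ n) (1 ℕ.+ n)) (M : Matrix n n) →
    (∀ i → subrank A (suc i) ≤ subrank M i) →
    weight A ≤ subrank A 0F ℕ.+ weight M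
  weight-peel¹-≤ A M h = begin
    weight A
      ≡⟨ weight≡total A ⟩
    subrank A 0F ℕ.+ total (λ i → subrank A (suc i))
      ≤⟨ ℕ.+-monoʳ-≤ (subrank A 0F) (total-mono h) ⟩
    subrank A 0F ℕ.+ total (λ i → subrank M i)
      ≡⟨ cong (λ x → subrank A 0F ℕ.+ x) (weight≡total M) ⟨
    subrank A 0F ℕ.+ weight M ∎
    where open ℕ.≤-Reasoning

  weight-peel²-≥ : ∀ {n} (A : Matrix (2 ℕ.+ n) (2 ℕ.+ n)) (M : Matrix n n) →
    (∀ i → subrank M i ≤ subrank A (suc (suc i))) →
    subrank A 0F ℕ.+ (subrank A 1F ℕ.+ weight M) ≤ weight A
  weight-peel²-≥ A M h = begin
    subrank A 0F ℕ.+ (subrank A 1F ℕ.+ weight M)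
      ≡⟨ cong (λ x → subrank A 0F ℕ.+ (subrank A 1F ℕ.+ x)) (weight≡total M) ⟩
    subrank A 0F ℕ.+ (subrank A 1F ℕ.+ total (λ i → subrank M i))
      ≤⟨ ℕ.+-monoʳ-≤ (subrank A 0F) (ℕ.+-monoʳ-≤ (subrank A 1F) (total-mono h)) ⟩
    subrank A 0F ℕ.+ (subrank A 1F ℕ.+ total (λ i → subrank A (suc (suc i))))
      ≡⟨ weight≡total A ⟨
    weight A ∎
    where open ℕ.≤-Reasoning

  weight-peel²-≤ : ∀ {n} (A : Matrix (2 ℕ.+ n) (2 ℕ.+ n)) (M : Matrix n n) →
    (∀ i → subrank A (suc (suc i)) ≤ subrank M i) →
    weight A ≤ subrank A 0F ℕ.+ (subrank A 1F ℕ.+ weight M)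
  weight-peel²-≤ A M h = begin
    weight A
      ≡⟨ weight≡total A ⟩
    subrank A 0F ℕ.+ (subrank A 1F ℕ.+ total (λ i → subrank A (suc (suc i))))
      ≤⟨ ℕ.+-monoʳ-≤ (subrank A 0F) (ℕ.+-monoʳ-≤ (subrank A 1F) (total-mono h)) ⟩
    subrank A 0F ℕ.+ (subrank A 1F ℕ.+ total (λ i → subrank M i))
      ≡⟨ cong (λ x → subrank A 0F ℕ.+ (subrank A 1F ℕ.+ x)) (weight≡total M) ⟨
    subrank A 0F ℕ.+ (subrank A 1F ℕ.+ weight M) ∎
    where open ℕ.≤-Reasoning

  weight-peel³-≥ : ∀ {n} (A : Matrix (3 ℕ.+ n) (3 ℕ.+ n)) (M : Matrix n n) →
    (∀ i → subrank M i ≤ subrank A (suc (suc (suc i)))) →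
    subrank A 0F ℕ.+ (subrank A 1F ℕ.+ (subrank A 2F ℕ.+ weight M)) ≤ weight A
  weight-peel³-≥ A M h = begin
    subrank A 0F ℕ.+ (subrank A 1F ℕ.+ (subrank A 2F ℕ.+ weight M))
      ≡⟨ cong (λ x → subrank A 0F ℕ.+ (subrank A 1F ℕ.+ (subrank A 2F ℕ.+ x))) (weight≡total M) ⟩
    subrank A 0F ℕ.+ (subrank A 1F ℕ.+ (subrank A 2F ℕ.+ total (λ i → subrank M i)))
      ≤⟨ ℕ.+-monoʳ-≤ (subrank A 0F)
        (ℕ.+-monoʳ-≤ (subrank A 1F) (ℕ.+-monoʳ-≤ (subrank A 2F) (total-mono h))) ⟩
    subrank A 0F ℕ.+ (subrank A 1F ℕ.+
      (subrank A 2F ℕ.+ total (λ i → subrank A (suc (suc (suc i))))))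
      ≡⟨ weight≡total A ⟨
    weight A ∎
    where open ℕ.≤-Reasoning

  weight-peel³-≤ : ∀ {n} (A : Matrix (3 ℕ.+ n) (3 ℕ.+ n)) (M : Matrix n n) →
    (∀ i → subrank A (suc (suc (suc i))) ≤ subrank M i) →
    weight A ≤ subrank A 0F ℕ.+ (subrank A 1F ℕ.+ (subrank A 2F ℕ.+ weight M))
  weight-peel³-≤ A M h = begin
    weight A
      ≡⟨ weight≡total A ⟩
    subrank A 0F ℕ.+ (subrank A 1F ℕ.+
      (subrank A 2F ℕ.+ total (λ i → subrank A (suc (suc (suc i))))))
      ≤⟨ ℕ.+-monoʳ-≤ (subrank A 0F)
        (ℕ.+-monoʳ-≤ (subrank A 1F) (ℕ.+-monoʳ-≤ (subrank A 2F) (total-mono h))) ⟩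
    subrank A 0F ℕ.+ (subrank A 1F ℕ.+ (subrank A 2F ℕ.+ total (λ i → subrank M i)))
      ≡⟨ cong (λ x → subrank A 0F ℕ.+ (subrank A 1F ℕ.+ (subrank A 2F ℕ.+ x))) (weight≡total M) ⟨
    subrank A 0F ℕ.+ (subrank A 1F ℕ.+ (subrank A 2F ℕ.+ weight M)) ∎
    where open ℕ.≤-Reasoning

  weight-∷ᵁ-≥ : ∀ {n} (r : Vec Carrier (1 ℕ.+ n)) (M : Matrix n n) → let A = r ∷ᵁ M in
    subrank A 0F ℕ.+ weight M ≤ weight A
  weight-∷ᵁ-≥ r M = weight-peel¹-≥ (r ∷ᵁ M) M (subrank-tail≤ r M)

  weight-∷ᵁ-≤ : ∀ {n} (r : Vec Carrier (1 ℕ.+ n)) (M : Matrix n n) → let A = r ∷ᵁ M in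
    (∀ c → lookup r (suc c) ≡ 0#) → weight A ≤ subrank A 0F ℕ.+ weight M
  weight-∷ᵁ-≤ r M r≡0 = weight-peel¹-≤ (r ∷ᵁ M) M λ i → subrank≤tail r M i λ { (suc c) _ → r≡0 c }

  weight-∷ᵁ²-≥ : ∀ {n} (r : Vec Carrier (2 ℕ.+ n)) (r₁ : Vec Carrier (1 ℕ.+ n)) (M : Matrix n n) →
    let A = r ∷ᵁ r₁ ∷ᵁ M in subrank A 0F ℕ.+ (subrank A 1F ℕ.+ weight M) ≤ weight A
  weight-∷ᵁ²-≥ r r₁ M = weight-peel²-≥ (r ∷ᵁ r₁ ∷ᵁ M) M λ i →
    ℕ.≤-trans (subrank-tail≤ r₁ M i) (subrank-tail≤ r (r₁ ∷ᵁ M) (suc i))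

  -- By the vanishing hypotheses neither of the two rows on top reaches the columns of `M`, so from
  -- the third submatrix on the ranks are bounded by those of `M`.
  weight-∷ᵁ²-≤ : ∀ {n} (r : Vec Carrier (2 ℕ.+ n)) (r₁ : Vec Carrier (1 ℕ.+ n)) (M : Matrix n n) →
    let A = r ∷ᵁ r₁ ∷ᵁ M in
    (∀ c → lookup r (suc (suc c)) ≡ 0#) → (∀ c → lookup r₁ (suc c) ≡ 0#) →
    weight A ≤ subrank A 0F ℕ.+ (subrank A 1F ℕ.+ weight M)
  weight-∷ᵁ²-≤ r r₁ M r≡0 r₁≡0 = weight-peel²-≤ (r ∷ᵁ r₁ ∷ᵁ M) M λ i →
    ℕ.≤-trans (subrank≤tail r (r₁ ∷ᵁ M) (suc i) λ { (suc zero) (s≤s ()); (suc (suc c)) _ → r≡0 c })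
      (subrank≤tail r₁ M i λ { (suc c) _ → r₁≡0 c })

  weight-∷ᵁ³-≥ : ∀ {n} (r : Vec Carrier (3 ℕ.+ n)) (r₁ : Vec Carrier (2 ℕ.+ n))
    (r₂ : Vec Carrier (1 ℕ.+ n)) (M : Matrix n n) →
    let A = r ∷ᵁ r₁ ∷ᵁ r₂ ∷ᵁ M in
    subrank A 0F ℕ.+ (subrank A 1F ℕ.+ (subrank A 2F ℕ.+ weight M)) ≤ weight A
  weight-∷ᵁ³-≥ r r₁ r₂ M = weight-peel³-≥ (r ∷ᵁ r₁ ∷ᵁ r₂ ∷ᵁ M) M λ i →
    ℕ.≤-trans (subrank-tail≤ r₂ M i)
      (ℕ.≤-trans (subrank-tail≤ r₁ (r₂ ∷ᵁ M) (suc i))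
        (subrank-tail≤ r (r₁ ∷ᵁ r₂ ∷ᵁ M) (suc (suc i))))

  weight-∷ᵁ³-≤ : ∀ {n} (r : Vec Carrier (3 ℕ.+ n)) (r₁ : Vec Carrier (2 ℕ.+ n))
    (r₂ : Vec Carrier (1 ℕ.+ n)) (M : Matrix n n) →
    let A = r ∷ᵁ r₁ ∷ᵁ r₂ ∷ᵁ M in
    (∀ c → lookup r (suc (suc (suc c))) ≡ 0#) → (∀ c → lookup r₁ (suc (suc c)) ≡ 0#) →
    (∀ c → lookup r₂ (suc c) ≡ 0#) →
    weight A ≤ subrank A 0F ℕ.+ (subrank A 1F ℕ.+ (subrank A 2F ℕ.+ weight M))
  weight-∷ᵁ³-≤ r r₁ r₂ M r≡0 r₁≡0 r₂≡0 = weight-peel³-≤ (r ∷ᵁ r₁ ∷ᵁ r₂ ∷ᵁ M) M λ i →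
    ℕ.≤-trans (subrank≤tail r (r₁ ∷ᵁ r₂ ∷ᵁ M) (suc (suc i))
      λ { (suc zero) (s≤s ()); (suc (suc zero)) (s≤s (s≤s ())); (suc (suc (suc c))) _ → r≡0 c })
    (ℕ.≤-trans (subrank≤tail r₁ (r₂ ∷ᵁ M)
      (suc i) λ { (suc zero) (s≤s ()); (suc (suc c)) _ → r₁≡0 c })
      (subrank≤tail r₂ M i λ { (suc c) _ → r₂≡0 c }))

  weight-first-three : ∀ {n} (A : Matrix (3 ℕ.+ n) (3 ℕ.+ n)) →
    subrank A 0F ℕ.+ (subrank A 1F ℕ.+ subrank A 2F) ≤ weight A
  weight-first-three A = begin
    subrank A 0F ℕ.+ (subrank A 1F ℕ.+ subrank A 2F)
      ≤⟨ ℕ.+-monoʳ-≤ (subrank A 0F) (ℕ.+-monoʳ-≤ (subrank A 1F) (ℕ.m≤m+n (subrank A 2F) _)) ⟩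
    total (λ i → subrank A i)
      ≡⟨ weight≡total A ⟨
    weight A ∎
    where open ℕ.≤-Reasoning

  weight-first-four : ∀ {n} (A : Matrix (4 ℕ.+ n) (4 ℕ.+ n)) →
    subrank A 0F ℕ.+ (subrank A 1F ℕ.+ (subrank A 2F ℕ.+ subrank A 3F)) ≤ weight A
  weight-first-four A = begin
    subrank A 0F ℕ.+ (subrank A 1F ℕ.+ (subrank A 2F ℕ.+ subrank A 3F))
      ≤⟨ ℕ.+-monoʳ-≤ (subrank A 0F)
        (ℕ.+-monoʳ-≤ (subrank A 1F) (ℕ.+-monoʳ-≤ (subrank A 2F) (ℕ.m≤m+n (subrank A 3F) _))) ⟩
    total (λ i → subrank A i)
      ≡⟨ weight≡total A ⟨
    weight A ∎
    where open ℕ.≤-Reasoning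

  -- The balls of radius at most 3 as lists

  nonzeros : List Carrier
  nonzeros = filter (λ x → ¬? (x ≟ 0#)) elements

  nonzeros-unique : Unique nonzeros
  nonzeros-unique = Unique.filter⁺ (λ x → ¬? (x ≟ 0#)) elements-unique

  ∈-nonzeros : ∀ {x} → x ≢ 0# → x ∈ nonzeros
  ∈-nonzeros {x} x≢0 = ∈-filter⁺ (λ x → ¬? (x ≟ 0#)) (∈-elements x) x≢0

  ∈-nonzeros⁻ : ∀ {x} → x ∈ nonzeros → x ≢ 0#
  ∈-nonzeros⁻ x∈ = proj₂ (∈-filter⁻ (λ x → ¬? (x ≟ 0#)) {xs = elements} x∈)

  1+length-nonzeros : suc (length nonzeros) ≡ q
  1+length-nonzeros = trans
    (unique-⊆-⊇⇒length≡ {xs = 0# ∷ nonzeros}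
      (All.tabulate (λ x∈ 0≡x → ∈-nonzeros⁻ x∈ (sym 0≡x)) ∷ nonzeros-unique)
      elements-unique (λ _ → ∈-elements _) split) length-elements
    where
    split : ∀ {x} → x ∈ elements → x ∈ 0# ∷ nonzeros
    split {x} _ with x ≟ 0#
    ... | yes refl = here refl
    ... | no x≢0   = there (∈-nonzeros x≢0)

  -- The `k` free entries of an extension together with its pivot, which `parameters` restricts to
  -- nonzero values; their number q^k (q - 1) is a coefficient of the recursion.
  Parameters : ℕ → Set
  Parameters k = Vec Carrier k × Carrier

  parameters : ∀ k → List (Parameters k)
  parameters k = cartesianProduct (vectors elements k) nonzeros

  parameters-unique : ∀ k → Unique (parameters k)
  parameters-unique k = Unique.cartesianProduct⁺ (vectors-unique elements-unique k) nonzeros-unique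

  ∈-parameters : ∀ {k} (v : Vec Carrier k) {x} → x ≢ 0# → (v , x) ∈ parameters k
  ∈-parameters v x≢0 = ∈-cartesianProduct⁺ (∈-vectors ∈-elements v) (∈-nonzeros x≢0)

  ∈-parameters⁻ : ∀ {k} {p : Parameters k} → p ∈ parameters k → proj₂ p ≢ 0#
  ∈-parameters⁻ {k} p∈ = ∈-nonzeros⁻ (proj₂ (∈-cartesianProduct⁻ (vectors elements k) nonzeros p∈))

  length-parameters : ∀ k → length (parameters k) ≡ q ℕ.^ k ℕ.* length nonzeros
  length-parameters k = trans (length-cartesianProductWith _,_ (vectors elements k) nonzeros)
    (cong (ℕ._* length nonzeros)
      (trans (length-vectors elements k) (cong (ℕ._^ k) length-elements)))

  -- In extendₖ the last nonzero entry of the first row is in column k (counted from 1), so that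
  -- M_[1], …, M_[k] are nonzero. In extend₃, M_[2] has rank 1 because the second row is a multiple
  -- of the first, up to the first column.
  extend₀ : ∀ {n} → Matrix n n → Matrix (1 ℕ.+ n) (1 ℕ.+ n)
  extend₀ M = zeros ∷ᵁ M

  extend₁ : ∀ {n} → Parameters 0 → Matrix n n → Matrix (1 ℕ.+ n) (1 ℕ.+ n)
  extend₁ ([] , x) M = (x ∷ zeros) ∷ᵁ M

  extend₂ : ∀ {n} → Parameters 2 → Matrix n n → Matrix (2 ℕ.+ n) (2 ℕ.+ n)
  extend₂ (x₁ ∷ y ∷ [] , x₂) M = (x₁ ∷ x₂ ∷ zeros) ∷ᵁ (y ∷ zeros) ∷ᵁ M

  extend₃ : ∀ {n} → Parameters 4 → Matrix n n → Matrix (3 ℕ.+ n) (3 ℕ.+ n)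
  extend₃ (x₁ ∷ x₂ ∷ y ∷ z ∷ [] , x₃) M =
    (x₁ ∷ x₂ ∷ x₃ ∷ zeros) ∷ᵁ (y * x₃ ⁻¹ * x₂ ∷ y ∷ zeros) ∷ᵁ (z ∷ zeros) ∷ᵁ M

  -- ball s n is the ball of radius s only for s ≤ 3.
  ball  : ℕ → ∀ n → List (Matrix n n)
  -- `ballₖ` collects the members whose first row has its last nonzero entry in column `k` or later.
  -- Its radius argument is lowered by k - 1: `ball₂ s` lies in the ball of radius `1 + s`, and
  -- `ball₃ s` in that of radius `2 + s`.
  ball₁ : ℕ → ∀ n → List (Matrix (1 ℕ.+ n) (1 ℕ.+ n))
  ball₂ : ℕ → ∀ n → List (Matrix (1 ℕ.+ n) (1 ℕ.+ n))
  ball₃ : ℕ → ∀ n → List (Matrix (2 ℕ.+ n) (2 ℕ.+ n))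
  ball s zero    = [] ∷ []
  ball s (suc n) = List.map extend₀ (ball s n) ++ ball₁ s n
  ball₁ zero    n = []
  ball₁ (suc s) n = cartesianProductWith extend₁ (parameters 0) (ball s n) ++ ball₂ s n
  ball₂ (suc s) (suc n) = cartesianProductWith extend₂ (parameters 2) (ball s n) ++ ball₃ s n
  ball₂ zero    n       = []
  ball₂ (suc s) zero    = []
  ball₃ (suc s) (suc n) = cartesianProductWith extend₃ (parameters 4) (ball s n)
  ball₃ zero    n       = []
  ball₃ (suc s) zero    = []

  record InBall (s : ℕ) {n : ℕ} (A : Matrix n n) : Set where
    constructor inBall
    field
      upperTriangular : UpperTriangular A
      weight≤         : weight A ≤ s

  -- Every listed matrix lies in the ball

  extend₀-sound : ∀ {s n} {M : Matrix n n} → InBall s M → InBall s (extend₀ M)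
  extend₀-sound {M = M} (inBall ut w≤) = inBall (upperTriangular-∷ᵁ zeros {M} ut)
    (ℕ.≤-trans (weight-∷ᵁ-≤ zeros M (λ c → lookup-zeros (suc c)))
      (ℕ.+-mono-≤ (subrank≤columns (extend₀ M) 0F 0 λ { 0F c _ _ → lookup-zeros c }) w≤))

  extend₁-sound : ∀ {s n} {M : Matrix n n} p → InBall s M → InBall (1 ℕ.+ s) (extend₁ p M)
  extend₁-sound {M = M} ([] , x) (inBall ut w≤) = inBall (upperTriangular-∷ᵁ (x ∷ zeros) {M} ut)
    (ℕ.≤-trans (weight-∷ᵁ-≤ (x ∷ zeros) M lookup-zeros)
      (ℕ.+-mono-≤ (subrank≤rows (extend₁ ([] , x) M) 0F) w≤))

  extend₂-sound : ∀ {s n} {M : Matrix n n} p → InBall s M → InBall (2 ℕ.+ s) (extend₂ p M)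
  extend₂-sound {M = M} p@(x₁ ∷ y ∷ [] , x₂) (inBall ut w≤) = inBall
    (upperTriangular-∷ᵁ (x₁ ∷ x₂ ∷ zeros) {(y ∷ zeros) ∷ᵁ M}
      (upperTriangular-∷ᵁ (y ∷ zeros) {M} ut))
    (ℕ.≤-trans (weight-∷ᵁ²-≤ (x₁ ∷ x₂ ∷ zeros) (y ∷ zeros) M lookup-zeros lookup-zeros)
      (ℕ.+-mono-≤ (subrank≤rows A 0F) (ℕ.+-mono-≤ (subrank≤columns A 1F 1 vanish) w≤)))
    where
    A = extend₂ p M
    vanish : ∀ r c → toℕ r ≤ 1 → 2 ≤ toℕ c → entry A r c ≡ 0#
    vanish 0F (suc (suc c)) _ _ = lookup-zeros c
    vanish 1F (suc (suc c)) _ _ = lookup-zeros c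
    vanish (suc (suc r)) c (s≤s ()) _
    vanish r 1F _ (s≤s ())

  -- The first three submatrices have rank at most 1 for three different reasons: a single row, rows
  -- that are multiples of the first row, a single column that can be nonzero. The nonzero pivot is
  -- what recovers `y` from the multiple of `x₃`.
  extend₃-sound : ∀ {s n} {M : Matrix n n} p → proj₂ p ≢ 0# → InBall s M →
    InBall (3 ℕ.+ s) (extend₃ p M)
  extend₃-sound {M = M} p@(x₁ ∷ x₂ ∷ y ∷ z ∷ [] , x₃) x₃≢0 (inBall ut w≤) = inBall
    (upperTriangular-∷ᵁ (x₁ ∷ x₂ ∷ x₃ ∷ zeros) {(y * x₃ ⁻¹ * x₂ ∷ y ∷ zeros) ∷ᵁ (z ∷ zeros) ∷ᵁ M}
      (upperTriangular-∷ᵁ (y * x₃ ⁻¹ * x₂ ∷ y ∷ zeros) {(z ∷ zeros) ∷ᵁ M}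
        (upperTriangular-∷ᵁ (z ∷ zeros) {M} ut)))
    (ℕ.≤-trans (weight-∷ᵁ³-≤ (x₁ ∷ x₂ ∷ x₃ ∷ zeros) (y * x₃ ⁻¹ * x₂ ∷ y ∷ zeros)
      (z ∷ zeros) M lookup-zeros lookup-zeros lookup-zeros)
      (ℕ.+-mono-≤ (subrank≤rows A 0F)
        (ℕ.+-mono-≤ (subrank-proportional A 1F factor (lookup (x₁ ∷ x₂ ∷ x₃ ∷ zeros)) proportional)
        (ℕ.+-mono-≤ (subrank≤columns A 2F 1 vanish) w≤))))
    where
    A = extend₃ p M
    l = y * x₃ ⁻¹
    factor : Fin _ → Carrier
    factor 0F = 1#
    factor (suc _) = l
    proportional : ∀ r c → toℕ r ≤ 1 → 1 ≤ toℕ c →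
      entry A r c ≡ factor r * lookup (x₁ ∷ x₂ ∷ x₃ ∷ zeros) c
    proportional 0F c _ _ = sym (*-identityˡ _)
    proportional 1F 1F _ _ = refl
    proportional 1F 2F _ _ = sym (/-cancel y x₃≢0)
    proportional 1F (suc (suc (suc c))) _ _ =
      trans (lookup-zeros c) (sym (trans (cong (l *_) (lookup-zeros c)) (zeroʳ l)))
    proportional (suc (suc r)) c (s≤s ()) _
    vanish : ∀ r c → toℕ r ≤ 2 → 3 ≤ toℕ c → entry A r c ≡ 0#
    vanish 0F (suc (suc (suc c))) _ _ = lookup-zeros c
    vanish 1F (suc (suc (suc c))) _ _ = lookup-zeros c
    vanish 2F (suc (suc (suc c))) _ _ = lookup-zeros c
    vanish (suc (suc (suc r))) c (s≤s (s≤s ())) _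
    vanish r 1F _ (s≤s ())
    vanish r 2F _ (s≤s (s≤s ()))

  ball-sound  : ∀ s n {A : Matrix n n} → A ∈ ball s n → InBall s A
  ball₁-sound : ∀ s n {A} → A ∈ ball₁ s n → InBall s A
  ball₂-sound : ∀ s n {A} → A ∈ ball₂ s n → InBall (suc s) A
  ball₃-sound : ∀ s n {A} → A ∈ ball₃ s n → InBall (2 ℕ.+ s) A
  ball-sound s zero (here refl) = inBall (λ ()) (ℕ.≤-trans (ℕ.≤-reflexive (weight≡total [])) z≤n)
  ball-sound s (suc n) A∈ with ∈-++⁻ (List.map extend₀ (ball s n)) A∈
  ... | inj₂ A∈₁ = ball₁-sound s n A∈₁
  ... | inj₁ A∈₀ with ∈-map⁻ extend₀ A∈₀
  ...   | M , M∈ , refl = extend₀-sound (ball-sound s n M∈)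
  ball₁-sound (suc s) n A∈ with ∈-++⁻ (cartesianProductWith extend₁ (parameters 0) (ball s n)) A∈
  ... | inj₂ A∈₂ = ball₂-sound s n A∈₂
  ... | inj₁ A∈₁ with ∈-cartesianProductWith⁻ extend₁ (parameters 0) (ball s n) A∈₁
  ...   | p , M , _ , M∈ , refl = extend₁-sound p (ball-sound s n M∈)
  ball₂-sound (suc s) (suc n) A∈ with ∈-++⁻
    (cartesianProductWith extend₂ (parameters 2) (ball s n)) A∈
  ... | inj₂ A∈₃ = ball₃-sound s n A∈₃
  ... | inj₁ A∈₂ with ∈-cartesianProductWith⁻ extend₂ (parameters 2) (ball s n) A∈₂
  ...   | p , M , _ , M∈ , refl = extend₂-sound p (ball-sound s n M∈)
  ball₃-sound (suc s) (suc n) A∈ with ∈-cartesianProductWith⁻ extend₃ (parameters 4) (ball s n) A∈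
  ... | p , M , p∈ , M∈ , refl = extend₃-sound p (∈-parameters⁻ p∈) (ball-sound s n M∈)

  -- Every matrix of the ball is listed

  ∈-ball₀ : ∀ {s n} {M : Matrix n n} → M ∈ ball s n → extend₀ M ∈ ball s (1 ℕ.+ n)
  ∈-ball₀ M∈ = ∈-++⁺ˡ (∈-map⁺ extend₀ M∈)

  ∈-ball₁ : ∀ {s n} {M : Matrix n n} {p} → p ∈ parameters 0 → M ∈ ball s n →
    extend₁ p M ∈ ball (1 ℕ.+ s) (1 ℕ.+ n)
  ∈-ball₁ {s} {n} p∈ M∈ =
    ∈-++⁺ʳ (List.map extend₀ (ball (1 ℕ.+ s) n)) (∈-++⁺ˡ (∈-cartesianProductWith⁺ extend₁ p∈ M∈))

  ∈-ball₂ : ∀ {s n} {M : Matrix n n} {p} → p ∈ parameters 2 → M ∈ ball s n →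
    extend₂ p M ∈ ball (2 ℕ.+ s) (2 ℕ.+ n)
  ∈-ball₂ {s} {n} p∈ M∈ = ∈-++⁺ʳ (List.map extend₀ (ball (2 ℕ.+ s) (1 ℕ.+ n)))
    (∈-++⁺ʳ (cartesianProductWith extend₁ (parameters 0) (ball (1 ℕ.+ s) (1 ℕ.+ n)))
      (∈-++⁺ˡ (∈-cartesianProductWith⁺ extend₂ p∈ M∈)))

  ∈-ball₃ : ∀ {s n} {M : Matrix n n} {p} → p ∈ parameters 4 → M ∈ ball s n →
    extend₃ p M ∈ ball (3 ℕ.+ s) (3 ℕ.+ n)
  ∈-ball₃ {s} {n} p∈ M∈ = ∈-++⁺ʳ (List.map extend₀ (ball (3 ℕ.+ s) (2 ℕ.+ n)))
    (∈-++⁺ʳ (cartesianProductWith extend₁ (parameters 0) (ball (2 ℕ.+ s) (2 ℕ.+ n)))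
      (∈-++⁺ʳ (cartesianProductWith extend₂ (parameters 2) (ball (1 ℕ.+ s) (1 ℕ.+ n)))
        (∈-cartesianProductWith⁺ extend₃ p∈ M∈)))

  -- `ball` recurses on a radius of the form `k + s′`; this extracts that form once the first `k`
  -- submatrices are known to use up at least `k`.
  budget : ∀ k {f s} → k ℕ.+ f ≤ s → ∃[ s′ ] (s ≡ k ℕ.+ s′ × f ≤ s′)
  budget k {f} {s} k+f≤s with ℕ.m≤n⇒∃[o]m+o≡n (ℕ.≤-trans (ℕ.m≤m+n k f) k+f≤s)
  ... | s′ , refl = s′ , refl , ℕ.+-cancelˡ-≤ k f s′ k+f≤s

  4≰3 : ∀ {f s} {X : Set} → 4 ≤ f → f ≤ s → s ≤ 3 → X
  4≰3 4≤f f≤s s≤3 = contradiction (ℕ.≤-trans 4≤f (ℕ.≤-trans f≤s s≤3)) λ { (s≤s (s≤s (s≤s ()))) }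

  nonzero⇒head≢0 : ∀ {n x} {j : Fin (suc n)} → lookup (x ∷ zeros) j ≢ 0# → x ≢ 0#
  nonzero⇒head≢0 {j = zero}  ≢0 = ≢0
  nonzero⇒head≢0 {j = suc j} ≢0 = contradiction (lookup-zeros j) ≢0

  module _ {n} (A : Matrix (4 ℕ.+ n) (4 ℕ.+ n)) where
    -- The entry of the first row lies in each of the first three submatrices and the other entry
    -- lies in the fourth, so four ranks are positive.
    4≤weight : (∃[ c ] entry A 0F (suc (suc c)) ≢ 0#) → ∀ {r} → toℕ r ≤ 3 →
      (∃[ c ] entry A r (suc (suc (suc c))) ≢ 0#) → 4 ≤ weight A
    4≤weight (c , ≢0) r≤3 (d , ≢0′) = ℕ.≤-trans
      (ℕ.+-mono-≤ (nonzero⇒1≤subrank A {0F} {0F} {suc (suc c)} z≤n z≤n ≢0)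
      (ℕ.+-mono-≤ (nonzero⇒1≤subrank A {1F} {0F} {suc (suc c)} z≤n (s≤s z≤n) ≢0)
      (ℕ.+-mono-≤ (nonzero⇒1≤subrank A {2F} {0F} {suc (suc c)} z≤n (s≤s (s≤s z≤n)) ≢0)
        (nonzero⇒1≤subrank A {3F} {_} {suc (suc (suc d))} r≤3 (s≤s (s≤s (s≤s z≤n))) ≢0′))))
      (weight-first-four A)

  -- The case split is on the last nonzero entry of the first row: `complete-short` treats column 1
  -- and the zero row, `complete-medium` column 2, `complete-long` everything further to the right.
  -- The bound `s ≤ 3` rules out all shapes other than the four extensions.
  ball-complete : ∀ s {n} (A : Matrix n n) → s ≤ 3 → InBall s A → A ∈ ball s n
  complete-short : ∀ s {n} x (M : Matrix n n) → s ≤ 3 → UpperTriangular M →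
    weight ((x ∷ zeros) ∷ᵁ M) ≤ s → (x ∷ zeros) ∷ᵁ M ∈ ball s (1 ℕ.+ n)
  complete-medium : ∀ s {n} x₁ x₂ y w (M : Matrix n n) → s ≤ 3 → UpperTriangular M → x₂ ≢ 0# →
    let A = (x₁ ∷ x₂ ∷ zeros) ∷ᵁ (y ∷ w) ∷ᵁ M in weight A ≤ s → A ∈ ball s (2 ℕ.+ n)
  complete-long : ∀ s {n} x₁ x₂ x₃ v y₁ y₂ w z u (M : Matrix n n) → s ≤ 3 → UpperTriangular M →
    (∃[ k ] lookup (x₃ ∷ v) k ≢ 0#) →
    let A = (x₁ ∷ x₂ ∷ x₃ ∷ v) ∷ᵁ (y₁ ∷ y₂ ∷ w) ∷ᵁ (z ∷ u) ∷ᵁ M in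
    weight A ≤ s → A ∈ ball s (3 ℕ.+ n)

  ball-complete s [] _ _ = here refl
  ball-complete s {suc n} A s≤3 (inBall ut w≤s) with upperTriangular-∷ᵁ⁻¹ A ut
  ... | (x ∷ v) , M , utM , refl with zeros? v
  ...   | inj₁ refl = complete-short s x M s≤3 utM w≤s
  ball-complete s {suc (suc n)} A s≤3 (inBall ut w≤s) | (x₁ ∷ x₂ ∷ v) , M , utM , refl
        | inj₂ (j , ≢0) with upperTriangular-∷ᵁ⁻¹ M utM | zeros? v
  ...     | (y ∷ w) , M₁ , utM₁ , refl | inj₁ refl =
    complete-medium s x₁ x₂ y w M₁ s≤3 utM₁ (nonzero⇒head≢0 {j = j} ≢0) w≤s
  ball-complete s {suc (suc (suc n))} A s≤3 (inBall ut w≤s) | (x₁ ∷ x₂ ∷ x₃ ∷ v) , M , utM , refl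
        | inj₂ (j , ≢0) | (y₁ ∷ y₂ ∷ w) , M₁ , utM₁ , refl | inj₂ k with upperTriangular-∷ᵁ⁻¹ M₁ utM₁
  ...       | (z ∷ u) , M₂ , utM₂ , refl = complete-long s x₁ x₂ x₃ v y₁ y₂ w z u M₂ s≤3 utM₂ k w≤s

  complete-short s x M s≤3 ut w≤s with x ≟ 0#
  ... | yes refl = ∈-ball₀ (ball-complete s M s≤3
    (inBall ut (ℕ.≤-trans (ℕ.m≤n+m _ _) (ℕ.≤-trans (weight-∷ᵁ-≥ zeros M) w≤s))))
  ... | no x≢0 with budget 1 (ℕ.≤-trans (ℕ.≤-trans
          (ℕ.+-monoˡ-≤ (weight M) (nonzero⇒1≤subrank ((x ∷ zeros) ∷ᵁ M) {0F} {0F} {0F} z≤n z≤n x≢0))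
          (weight-∷ᵁ-≥ (x ∷ zeros) M)) w≤s)
  ...   | s′ , refl , wM≤s′ = ∈-ball₁ (∈-parameters [] x≢0)
    (ball-complete s′ M (ℕ.≤-trans (ℕ.n≤1+n s′) s≤3) (inBall ut wM≤s′))

  complete-medium s x₁ x₂ y w M s≤3 ut x₂≢0 w≤s with zeros? w
  -- A nonzero entry of `w` forms a nonzero minor with `x₂`, because the first row is 0 above it.
  -- The first three ranks are then at least 1, 2 and 1.
  complete-medium s {suc n} x₁ x₂ y w M s≤3 ut x₂≢0 w≤s | inj₂ (k , wk≢0) = 4≰3 (ℕ.≤-trans
    (ℕ.+-mono-≤ (nonzero⇒1≤subrank A {0F} {0F} {1F} z≤n z≤n x₂≢0)
    (ℕ.+-mono-≤ (minor⇒2≤subrank A {1F} {0F} {1F} {1F} {suc (suc k)} z≤n (s≤s z≤n) (s≤s z≤n)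
      (s≤s z≤n) (λ ()) minor)
      (nonzero⇒1≤subrank A {2F} {1F} {suc (suc k)} (s≤s z≤n) (s≤s (s≤s z≤n)) wk≢0)))
    (weight-first-three A)) w≤s s≤3
    where
    A = (x₁ ∷ x₂ ∷ zeros) ∷ᵁ (y ∷ w) ∷ᵁ M
    minor : x₂ * lookup w k ≢ lookup zeros k * y
    minor eq = wk≢0 (*-cancelˡ x₂≢0
      (trans eq (trans (cong (_* y) (lookup-zeros k)) (trans (zeroˡ y) (sym (zeroʳ x₂))))))
  complete-medium s x₁ x₂ y w M s≤3 ut x₂≢0 w≤s | inj₁ refl with budget 2 (ℕ.≤-trans (ℕ.≤-trans
      (ℕ.+-mono-≤ (nonzero⇒1≤subrank A {0F} {0F} {1F} z≤n z≤n x₂≢0)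
        (ℕ.+-monoˡ-≤ (weight M) (nonzero⇒1≤subrank A {1F} {0F} {1F} z≤n (s≤s z≤n) x₂≢0)))
      (weight-∷ᵁ²-≥ (x₁ ∷ x₂ ∷ zeros) (y ∷ zeros) M)) w≤s)
    where A = (x₁ ∷ x₂ ∷ zeros) ∷ᵁ (y ∷ zeros) ∷ᵁ M
  ... | s′ , refl , wM≤s′ = ∈-ball₂ (∈-parameters (x₁ ∷ y ∷ []) x₂≢0)
    (ball-complete s′ M (ℕ.≤-trans (ℕ.m≤n+m s′ 2) s≤3) (inBall ut wM≤s′))

  complete-long s x₁ x₂ x₃ v y₁ y₂ w z u M s≤3 ut k w≤s with zeros? v | zeros? w | zeros? u
  complete-long s {suc n} x₁ x₂ x₃ v y₁ y₂ w z u M s≤3 ut (k , ≢0) w≤s | inj₂ (l , ≢0′) | _ | _ =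
    4≰3 (4≤weight A (k , ≢0) {0F} z≤n (l , ≢0′)) w≤s s≤3
    where A = (x₁ ∷ x₂ ∷ x₃ ∷ v) ∷ᵁ (y₁ ∷ y₂ ∷ w) ∷ᵁ (z ∷ u) ∷ᵁ M
  complete-long s {suc n} x₁ x₂ x₃ v y₁ y₂ w z u M s≤3 ut (k , ≢0) w≤s | _ | inj₂ (l , ≢0′) | _ =
    4≰3 (4≤weight A (k , ≢0) {1F} (s≤s z≤n) (l , ≢0′)) w≤s s≤3
    where A = (x₁ ∷ x₂ ∷ x₃ ∷ v) ∷ᵁ (y₁ ∷ y₂ ∷ w) ∷ᵁ (z ∷ u) ∷ᵁ M
  complete-long s {suc n} x₁ x₂ x₃ v y₁ y₂ w z u M s≤3 ut (k , ≢0) w≤s | _ | _ | inj₂ (l , ≢0′) =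
    4≰3 (4≤weight A (k , ≢0) {2F} (s≤s (s≤s z≤n)) (l , ≢0′)) w≤s s≤3
    where A = (x₁ ∷ x₂ ∷ x₃ ∷ v) ∷ᵁ (y₁ ∷ y₂ ∷ w) ∷ᵁ (z ∷ u) ∷ᵁ M
  complete-long s x₁ x₂ x₃ v y₁ y₂ w z u M s≤3 ut (k , ≢0) w≤s | inj₁ refl | inj₁ refl | inj₁ refl =
    finish (nonzero⇒head≢0 {j = k} ≢0)
    where
    A = (x₁ ∷ x₂ ∷ x₃ ∷ zeros) ∷ᵁ (y₁ ∷ y₂ ∷ zeros) ∷ᵁ (z ∷ zeros) ∷ᵁ M
    finish : x₃ ≢ 0# → A ∈ ball s _
    -- This compares the two products of the minor of the first two rows in columns 2 and 3. If it
    -- is nonzero, the ranks are at least 1, 2 and 1; if it vanishes, `y₁` is determined by the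
    -- other entries, as in `extend₃`.
    finish x₃≢0 with (x₂ * y₂) ≟ (x₃ * y₁)
    ... | no minor = 4≰3 (ℕ.≤-trans
      (ℕ.+-mono-≤ (nonzero⇒1≤subrank A {0F} {0F} {2F} z≤n z≤n x₃≢0)
      (ℕ.+-mono-≤ (minor⇒2≤subrank A {1F} {0F} {1F} {1F} {2F} z≤n (s≤s z≤n) (s≤s z≤n) (s≤s z≤n)
        (λ ()) minor)
        (nonzero⇒1≤subrank A {2F} {0F} {2F} z≤n (s≤s (s≤s z≤n)) x₃≢0)))
      (weight-first-three A)) w≤s s≤3
    ... | yes x₂y₂≡x₃y₁ with budget 3 (ℕ.≤-trans (ℕ.≤-trans
        (ℕ.+-mono-≤ (nonzero⇒1≤subrank A {0F} {0F} {2F} z≤n z≤n x₃≢0)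
        (ℕ.+-mono-≤ (nonzero⇒1≤subrank A {1F} {0F} {2F} z≤n (s≤s z≤n) x₃≢0)
          (ℕ.+-monoˡ-≤ (weight M) (nonzero⇒1≤subrank A {2F} {0F} {2F} z≤n (s≤s (s≤s z≤n)) x₃≢0))))
        (weight-∷ᵁ³-≥ (x₁ ∷ x₂ ∷ x₃ ∷ zeros) (y₁ ∷ y₂ ∷ zeros) (z ∷ zeros) M)) w≤s)
    ...   | s′ , refl , wM≤s′ = subst
      (λ y → (x₁ ∷ x₂ ∷ x₃ ∷ zeros) ∷ᵁ (y ∷ y₂ ∷ zeros) ∷ᵁ (z ∷ zeros) ∷ᵁ M ∈
        ball (3 ℕ.+ s′) _) y≡y₁
      (∈-ball₃ (∈-parameters (x₁ ∷ x₂ ∷ y₂ ∷ z ∷ []) x₃≢0)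
        (ball-complete s′ M (ℕ.≤-trans (ℕ.m≤n+m s′ 3) s≤3) (inBall ut wM≤s′)))
      where
      y≡y₁ : y₂ * x₃ ⁻¹ * x₂ ≡ y₁
      y≡y₁ = *-cancelˡ x₃≢0 (begin
        x₃ * (y₂ * x₃ ⁻¹ * x₂)   ≡⟨ *-assoc x₃ (y₂ * x₃ ⁻¹) x₂ ⟨
        x₃ * (y₂ * x₃ ⁻¹) * x₂   ≡⟨ cong (_* x₂) (*-comm x₃ (y₂ * x₃ ⁻¹)) ⟩
        y₂ * x₃ ⁻¹ * x₃ * x₂     ≡⟨ cong (_* x₂) (/-cancel y₂ x₃≢0) ⟩
        y₂ * x₂                  ≡⟨ *-comm y₂ x₂ ⟩
        x₂ * y₂                  ≡⟨ x₂y₂≡x₃y₁ ⟩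
        x₃ * y₁                  ∎)
        where open ≡-Reasoning

  -- No matrix is listed twice, and the resulting count

  extend₁-injective : ∀ {n} {p p′} {M M′ : Matrix n n} → extend₁ p M ≡ extend₁ p′ M′ →
    p ≡ p′ × M ≡ M′
  extend₁-injective {p = [] , x} {[] , x′} eq with ∷ᵁ-injective eq
  ... | refl , refl = refl , refl

  extend₂-injective : ∀ {n} {p p′} {M M′ : Matrix n n} → extend₂ p M ≡ extend₂ p′ M′ →
    p ≡ p′ × M ≡ M′
  extend₂-injective {p = x₁ ∷ y ∷ [] , x₂} {x₁′ ∷ y′ ∷ [] , x₂′} eq with ∷ᵁ-injective eq
  ... | refl , eq₁ with ∷ᵁ-injective eq₁
  ...   | refl , refl = refl , refl

  extend₃-injective : ∀ {n} {p p′} {M M′ : Matrix n n} → extend₃ p M ≡ extend₃ p′ M′ →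
    p ≡ p′ × M ≡ M′
  extend₃-injective {p = x₁ ∷ x₂ ∷ y ∷ z ∷ [] , x₃} {x₁′ ∷ x₂′ ∷ y′ ∷ z′ ∷ [] , x₃′} eq with ∷ᵁ-injective eq
  ... | refl , eq₁ with ∷ᵁ-injective eq₁
  -- The first entry of the second row is a compound term and cannot be matched on. The second entry
  -- is `y` itself, and equating it makes the first entries agree.
  ...   | rows≡ , eq₂ with cong (λ r → lookup r 1F) rows≡ | ∷ᵁ-injective eq₂
  ...     | refl | refl , refl = refl , refl

  -- Separates the pieces of the list: an `extend₂` matrix has only zeros in its first row from the
  -- third column on. The two lemmas that follow do the same for `extend₁` and `extend₀`.
  ball₃-head : ∀ s n {A} → A ∈ ball₃ s n → ∃[ j ] entry A 0F (suc (suc j)) ≢ 0#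
  ball₃-head (suc s) (suc n) A∈ with ∈-cartesianProductWith⁻ extend₃ (parameters 4) (ball s n) A∈
  ... | (x₁ ∷ x₂ ∷ y ∷ z ∷ [] , x₃) , M , p∈ , _ , refl = 0F , ∈-parameters⁻ p∈

  ball₂-head : ∀ s n {A} → A ∈ ball₂ s n → ∃[ j ] entry A 0F (suc j) ≢ 0#
  ball₂-head (suc s) (suc n) A∈ with ∈-++⁻
    (cartesianProductWith extend₂ (parameters 2) (ball s n)) A∈
  ... | inj₂ A∈₃ with ball₃-head s n A∈₃
  ...   | j , ≢0 = suc j , ≢0
  ball₂-head (suc s) (suc n) A∈ | inj₁ A∈₂ with ∈-cartesianProductWith⁻ extend₂ (parameters 2)
    (ball s n) A∈₂
  ... | (x₁ ∷ y ∷ [] , x₂) , M , p∈ , _ , refl = 0F , ∈-parameters⁻ p∈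

  ball₁-head : ∀ s n {A} → A ∈ ball₁ s n → ∃[ j ] entry A 0F j ≢ 0#
  ball₁-head (suc s) n A∈ with ∈-++⁻ (cartesianProductWith extend₁ (parameters 0) (ball s n)) A∈
  ... | inj₂ A∈₂ with ball₂-head s n A∈₂
  ...   | j , ≢0 = suc j , ≢0
  ball₁-head (suc s) n A∈ | inj₁ A∈₁ with ∈-cartesianProductWith⁻ extend₁ (parameters 0)
    (ball s n) A∈₁
  ... | ([] , x) , M , p∈ , _ , refl = 0F , ∈-parameters⁻ p∈

  ball-unique  : ∀ s n → Unique (ball s n)
  ball₁-unique : ∀ s n → Unique (ball₁ s n)
  ball₂-unique : ∀ s n → Unique (ball₂ s n)
  ball₃-unique : ∀ s n → Unique (ball₃ s n)
  ball-unique s zero    = All.[] ∷ []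
  ball-unique s (suc n) = Unique.++⁺
    (Unique.map⁺ (λ eq → proj₂ (∷ᵁ-injective {r = zeros} {zeros} eq)) (ball-unique s n))
      (ball₁-unique s n) disjoint
    where
    disjoint : Disjoint (List.map extend₀ (ball s n)) (ball₁ s n)
    disjoint (A∈₀ , A∈₁) with ∈-map⁻ extend₀ A∈₀ | ball₁-head s n A∈₁
    ... | M , _ , refl | j , ≢0 = ≢0 (lookup-zeros j)
  ball₁-unique zero    n = []
  ball₁-unique (suc s) n = Unique.++⁺
    (Unique.cartesianProductWith⁺ extend₁ extend₁-injective (parameters-unique 0)
      (ball-unique s n)) (ball₂-unique s n) disjoint
    where
    disjoint : Disjoint (cartesianProductWith extend₁ (parameters 0) (ball s n)) (ball₂ s n)
    disjoint (A∈₁ , A∈₂) with ∈-cartesianProductWith⁻ extend₁ (parameters 0)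
      (ball s n) A∈₁ | ball₂-head s n A∈₂
    ... | ([] , x) , M , _ , _ , refl | j , ≢0 = ≢0 (lookup-zeros j)
  ball₂-unique zero    n       = []
  ball₂-unique (suc s) zero    = []
  ball₂-unique (suc s) (suc n) = Unique.++⁺
    (Unique.cartesianProductWith⁺ extend₂ extend₂-injective (parameters-unique 2)
      (ball-unique s n)) (ball₃-unique s n) disjoint
    where
    disjoint : Disjoint (cartesianProductWith extend₂ (parameters 2) (ball s n)) (ball₃ s n)
    disjoint (A∈₂ , A∈₃) with ∈-cartesianProductWith⁻ extend₂ (parameters 2)
      (ball s n) A∈₂ | ball₃-head s n A∈₃
    ... | (x₁ ∷ y ∷ [] , x₂) , M , _ , _ , refl | j , ≢0 = ≢0 (lookup-zeros j)
  ball₃-unique zero    n       = []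
  ball₃-unique (suc s) zero    = []
  ball₃-unique (suc s) (suc n) =
    Unique.cartesianProductWith⁺ extend₃ extend₃-injective (parameters-unique 4) (ball-unique s n)

  ∈-matrices : ∀ {m n} (M : Matrix m n) → M ∈ matrices m n
  ∈-matrices = ∈-vectors (∈-vectors ∈-elements)

  matrices-unique : ∀ m n → Unique (matrices m n)
  matrices-unique m n = vectors-unique (vectors-unique elements-unique n) m

  b≡length-ball : ∀ n s → s ≤ 3 → b n s ≡ length (ball s n)
  b≡length-ball n s s≤3 =
    unique-⊆-⊇⇒length≡ (Unique.filter⁺ P? (matrices-unique n n)) (ball-unique s n)
    (λ A∈ → complete (proj₂ (∈-filter⁻ P? {xs = matrices n n} A∈)))
    (λ A∈ → ∈-filter⁺ P? (∈-matrices _) (sound (ball-sound s n A∈)))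
    where
    P? = λ (A : Matrix n n) → upperTriangular? A ×-dec (fr A ℕ.≤? s)
    complete : ∀ {A} → UpperTriangular A × fr A ≤ s → A ∈ ball s n
    complete {A} (ut , fr≤s) =
      ball-complete s A s≤3 (inBall ut (subst (_≤ s) (sym (weight≡fr A)) fr≤s))
    sound : ∀ {A} → InBall s A → UpperTriangular A × fr A ≤ s
    sound {A} (inBall ut w≤s) = ut , subst (_≤ s) (weight≡fr A) w≤s

  length-ball-suc : ∀ s n → length (ball s (suc n)) ≡ length (ball s n) ℕ.+ length (ball₁ s n)
  length-ball-suc s n = trans (List.length-++ (List.map extend₀ (ball s n)))
    (cong (ℕ._+ length (ball₁ s n)) (List.length-map extend₀ (ball s n)))

  length-step : ∀ {k m n} (f : Parameters k → Matrix n n → Matrix m m) (Ms : List (Matrix n n)) Ns →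
    length (cartesianProductWith f
      (parameters k) Ms ++ Ns) ≡ q ℕ.^ k ℕ.* length nonzeros ℕ.* length Ms ℕ.+ length Ns
  length-step {k} f Ms Ns = trans (List.length-++ (cartesianProductWith f (parameters k) Ms))
    (cong (ℕ._+ length Ns) (trans (length-cartesianProductWith f (parameters k) Ms)
      (cong (ℕ._* length Ms) (length-parameters k))))

  -- Matrices supported in four columns, and the entries outside them

  bound : ℕ → ℕ
  bound i = suc i ⊓ (4 ∸ i)

  -- From one submatrix to the next the rows grow by one while the columns left among the first four
  -- shrink by one. From the fifth on, truncated subtraction leaves no column, so the terms are 0.
  total-bound≤6 : ∀ n → total {n} (bound ∘ toℕ) ≤ 6
  total-bound≤6 0 = ℕ.≤ᵇ⇒≤ _ _ _
  total-bound≤6 1 = ℕ.≤ᵇ⇒≤ _ _ _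
  total-bound≤6 2 = ℕ.≤ᵇ⇒≤ _ _ _
  total-bound≤6 3 = ℕ.≤ᵇ⇒≤ _ _ _
  total-bound≤6 (suc (suc (suc (suc n)))) =
    ℕ.≤-reflexive (cong (6 ℕ.+_)
      (total-zero {n} λ i → cong (suc (4 ℕ.+ toℕ i) ⊓_) (ℕ.0∸n≡0 (toℕ i))))

  weight≤6 : ∀ {n} (M : Matrix n n) → (∀ i j → 4 ≤ toℕ j → entry M i j ≡ 0#) → weight M ≤ 6
  weight≤6 {n} M vanish = begin
    weight M                ≡⟨ weight≡total M ⟩
    total (subrank M)       ≤⟨ total-mono
      (λ i → ℕ.⊓-glb (subrank≤rows M i) (subrank≤columns M i (4 ∸ toℕ i)
                                 λ r c _ h → vanish r c (ℕ.≤-trans (ℕ.m≤n+m∸n 4 (toℕ i)) h))) ⟩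
    total {n} (bound ∘ toℕ) ≤⟨ total-bound≤6 n ⟩
    6                       ∎
    where open ℕ.≤-Reasoning

  -- Row by row, `m` full rows and then a triangle. For `m = 4` these are the entries on or above
  -- the diagonal of an upper triangular matrix whose first four columns have been removed.
  staircase : ∀ m {d} → Matrix (m ℕ.+ d) d → Vec Carrier (stairs m d)
  staircase zero    {zero}  []      = []
  staircase zero    {suc d} (r ∷ R) = r Vec.++ staircase zero (Vec.map Vec.tail R)
  staircase (suc m) {d}     (r ∷ R) = r Vec.++ staircase m R

  lookup-tail : ∀ {d} (v : Vec Carrier (suc d)) j → lookup (Vec.tail v) j ≡ lookup v (suc j)
  lookup-tail (x ∷ v) j = refl

  staircase-injective : ∀ m {d} (A B : Matrix (m ℕ.+ d) d) → staircase m A ≡ staircase m B →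
    ∀ i j → toℕ i ≤ m ℕ.+ toℕ j → entry A i j ≡ entry B i j
  staircase-injective zero {suc d} (r ∷ R) (r′ ∷ R′) eq zero j _ =
    cong (λ v → lookup v j) (Vec.++-injectiveˡ r r′ eq)
  staircase-injective zero {suc d} (r ∷ R) (r′ ∷ R′) eq (suc i) (suc j) (s≤s i≤j) =
    subst₂ _≡_ (tails R) (tails R′)
    (staircase-injective zero (Vec.map Vec.tail R) (Vec.map Vec.tail R′)
      (Vec.++-injectiveʳ r r′ eq) i j i≤j)
    where
    tails : ∀ S → entry (Vec.map Vec.tail S) i j ≡ entry S i (suc j)
    tails S = trans (cong (λ v → lookup v j) (Vec.lookup-map i Vec.tail S))
      (lookup-tail (lookup S i) j)
  staircase-injective (suc m) (r ∷ R) (r′ ∷ R′) eq zero j _ =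
    cong (λ v → lookup v j) (Vec.++-injectiveˡ r r′ eq)
  staircase-injective (suc m) (r ∷ R) (r′ ∷ R′) eq (suc i) j (s≤s i≤) =
    staircase-injective m R R′ (Vec.++-injectiveʳ r r′ eq) i j i≤

  -- Linear combinations and the number of codewords

  entry-combination : ∀ {k m n} (c : Vec Carrier k) (B : Vec (Matrix m n) k) i j →
    entry (linearCombination c B) i j ≡ ∑ λ s → lookup c s * entry (lookup B s) i j
  entry-combination c B = entry-mkMatrix λ i j → ∑ λ s → lookup c s * entry (lookup B s) i j

  combination-difference : ∀ {k m n} (B : Vec (Matrix m n) k) {c c′} i j →
    entry (linearCombination c B) i j ≡ entry (linearCombination c′ B) i j →
    entry (linearCombination (c -ⱽ c′) B) i j ≡ 0#
  combination-difference B {c} {c′} i j eq = trans (entry-combination (c -ⱽ c′) B i j)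
    (∑-minus≡0 c c′ (λ s → entry (lookup B s) i j)
      (trans (sym (entry-combination c B i j)) (trans eq (entry-combination c′ B i j))))

  entry-0ᴹ : ∀ {m n} i j → entry (0ᴹ {m} {n}) i j ≡ 0#
  entry-0ᴹ = entry-mkMatrix λ _ _ → 0#

  module _ {n : ℕ} (C : LinearCode n) where
    open LinearCode C

    combination-closed : ∀ {k} (c : Vec Carrier k) B →
      (∀ s → Member (lookup B s)) → Member (linearCombination c B)
    combination-closed []      []      _       = 0-closed
    combination-closed (x ∷ c) (A ∷ B) members = subst Member
      (matrix-ext λ i j → begin
        entry ((x *ᴹ A) +ᴹ linearCombination c B) i j
          ≡⟨ entry-mkMatrix (λ i j → entry (x *ᴹ A) i j + entry (linearCombination c B) i j) i j ⟩
        entry (x *ᴹ A) i j + entry (linearCombination c B) i j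
          ≡⟨ cong₂ _+_ (entry-mkMatrix (λ i j → x * entry A i j) i j) (entry-combination c B i j) ⟩
        x * entry A i j + ∑ (λ s → lookup c s * entry (lookup B s) i j)
          ≡⟨ entry-combination (x ∷ c) (A ∷ B) i j ⟨
        entry (linearCombination (x ∷ c) (A ∷ B)) i j ∎)
      (+-closed (*-closed x (members zero)) (combination-closed c B (members ∘ suc)))
      where open ≡-Reasoning

    module _ {k : ℕ} (B : Vec (Matrix n n) k) (members : ∀ s → Member (lookup B s))
      (independent : ∀ c → linearCombination c B ≡ 0ᴹ → c ≡ Vec.replicate k 0#) where

      difference≡0⇒≡ : ∀ {c c′} → linearCombination (c -ⱽ c′) B ≡ 0ᴹ → c ≡ c′
      difference≡0⇒≡ {c} {c′} eq = -ⱽ≡0⇒≡ λ i →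
        trans (cong (λ v → lookup v i) (independent (c -ⱽ c′) eq)) (lookup-zeros i)

      combination-injective : ∀ {c c′} → linearCombination c B ≡ linearCombination c′ B → c ≡ c′
      combination-injective {c} {c′} eq = difference≡0⇒≡ (matrix-ext λ i j →
        trans (combination-difference B {c} {c′} i j (cong (λ M → entry M i j) eq))
          (sym (entry-0ᴹ i j)))

      cardinality≡q^k : (∀ M → Member M → ∃[ c ] linearCombination c B ≡ M) →
        cardinality member? ≡ q ℕ.^ k
      cardinality≡q^k spanning = trans
        (unique-⊆-⊇⇒length≡ (Unique.filter⁺ member? (matrices-unique n n))
          (Unique.map⁺ combination-injective (vectors-unique elements-unique k))
          (λ M∈ → combination∈ (proj₂ (∈-filter⁻ member? {xs = matrices n n} M∈)))
          (λ M∈ → member∈ M∈))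
        (trans (List.length-map (λ c → linearCombination c B)
          (vectors elements k)) length-coefficients)
        where
        combinations = List.map (λ c → linearCombination c B) (vectors elements k)
        combination∈ : ∀ {M} → Member M → M ∈ combinations
        combination∈ {M} M∈C with spanning M M∈C
        ... | c , refl = ∈-map⁺ (λ c → linearCombination c B) (∈-vectors ∈-elements c)
        member∈ : ∀ {M} → M ∈ combinations → M ∈ filter member? (matrices n n)
        member∈ M∈ with ∈-map⁻ (λ c → linearCombination c B) M∈
        ... | c , _ , refl = ∈-filter⁺ member? (∈-matrices _) (combination-closed c B members)
        length-coefficients : length (vectors elements k) ≡ q ℕ.^ k
        length-coefficients = trans (length-vectors elements k) (cong (ℕ._^ k) length-elements)

  -- Consequences of distance 7

  record Distance7 {n : ℕ} (C : LinearCode n) : Set where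
    open LinearCode C
    field
      codeword  : ∃[ M ] (Member M × M ≢ 0ᴹ)
      separated : ∀ M → Member M → M ≢ 0ᴹ → 7 ≤ weight M

  distance7 : ∀ {n} (C : LinearCode n) → IsMinimumDistance C 7 → Distance7 C
  distance7 C ((M , M∈C , M≢0 , _) , separated) = record
    { codeword  = M , M∈C , M≢0
    ; separated = λ M M∈C M≢0 → ℕ.≤-trans (separated M M∈C M≢0) (ℕ.≤-reflexive (sym (weight≡fr M)))
    }

  module _ {n : ℕ} (C : LinearCode n) (D : Distance7 C) where
    open LinearCode C
    open Distance7 D

    columns<4⇒0 : ∀ {M} → Member M → (∀ i j → 4 ≤ toℕ j → entry M i j ≡ 0#) → M ≡ 0ᴹ
    columns<4⇒0 {M} M∈C vanish with Vec.≡-dec (Vec.≡-dec _≟_) M 0ᴹ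
    ... | yes M≡0 = M≡0
    ... | no  M≢0 = contradiction (ℕ.≤-trans (separated M M∈C M≢0) (weight≤6 M vanish))
        (ℕ.<⇒≱ ℕ.≤-refl)

    -- For smaller `n` no column has index 4 or more, so the vanishing condition is vacuous and the
    -- nonzero codeword would be zero.
    4≤n : 4 ≤ n
    4≤n with 4 ℕ.≤? n | codeword
    ... | yes 4≤n | _ = 4≤n
    ... | no  4≰n | M , M∈C , M≢0 = contradiction (columns<4⇒0 M∈C λ i j 4≤j →
      contradiction (ℕ.≤-trans 4≤j (ℕ.<⇒≤ (Fin.toℕ<n j))) 4≰n) M≢0

  dimension≤stairs : ∀ {d} (C : LinearCode (4 ℕ.+ d)) → Distance7 C →
    ∀ {k} → HasDimension C k → k ≤ stairs 4 d
  dimension≤stairs {d} C minimum {k} (B , members , independent , _) =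
    vec-injection⇒≤ puncture injective
    where
    open LinearCode C
    right : Matrix (4 ℕ.+ d) (4 ℕ.+ d) → Matrix (4 ℕ.+ d) d
    right M = mkMatrix λ i j → entry M i (4 ↑ʳ j)
    puncture : Vec Carrier k → Vec Carrier (stairs 4 d)
    puncture c = staircase 4 (right (linearCombination c B))
    entry-right : ∀ M i j → entry (right M) i j ≡ entry M i (4 ↑ʳ j)
    entry-right M = entry-mkMatrix λ i j → entry M i (4 ↑ʳ j)
    injective : ∀ {c c′} → puncture c ≡ puncture c′ → c ≡ c′
    injective {c} {c′} eq = difference≡0⇒≡ C B members independent
      (columns<4⇒0 C minimum (combination-closed C (c -ⱽ c′) B members) vanish)
      where
      vanish : ∀ i j → 4 ≤ toℕ j → entry (linearCombination (c -ⱽ c′) B) i j ≡ 0#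
      -- Below the diagonal the entry vanishes because the code is upper triangular; elsewhere it is
      -- recorded by `staircase`, where the two combinations agree.
      vanish i (suc (suc (suc (suc j)))) _ with toℕ i ℕ.≤? 4 ℕ.+ toℕ j
      ... | no  i≰j = upperTriangular (combination-closed C (c -ⱽ c′) B members) i (4 ↑ʳ j)
          (ℕ.≰⇒> i≰j)
      ... | yes i≤j = combination-difference B {c} {c′} i (4 ↑ʳ j) (subst₂ _≡_
        (entry-right (linearCombination c B) i j) (entry-right (linearCombination c′ B) i j)
        (staircase-injective 4 (right (linearCombination c B))
          (right (linearCombination c′ B)) eq i j i≤j))
      vanish i 1F (s≤s ())
      vanish i 2F (s≤s (s≤s ()))
      vanish i 3F (s≤s (s≤s (s≤s ())))

  codimension≥10 : ∀ {n} (C : LinearCode n) → Distance7 C → ∀ α → HasCodimension C α → 10 ≤ α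
  codimension≥10 C minimum α (k , dimension , k+α≡) with ℕ.m≤n⇒∃[o]m+o≡n (4≤n C minimum)
  ... | d , refl = ℕ.+-cancelʳ-≤ (stairs 4 d) 10 α (begin
    10 ℕ.+ stairs 4 d                          ≡⟨ dimension≡10+stairs d ⟨
    ((4 ℕ.+ d) ℕ.* (4 ℕ.+ d ℕ.+ 1)) ℕ./ 2      ≡⟨ k+α≡ ⟨
    k ℕ.+ α                                    ≤⟨ ℕ.+-monoˡ-≤ α
      (dimension≤stairs C minimum dimension) ⟩
    stairs 4 d ℕ.+ α                           ≡⟨ ℕ.+-comm (stairs 4 d) α ⟩
    α ℕ.+ stairs 4 d                           ∎)
    where open ℕ.≤-Reasoning

-- Ball sizes as integer polynomials

open import Data.Integer using (ℤ; +_; -_; _+_; _-_; _*_; _^_)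
import Data.Integer.Properties as ℤ
open import Data.Integer.Tactic.RingSolver using (solve-∀)
open import Function.Bundles using (_⇔_; mk⇔; Equivalence)

pos-^ : ∀ m n → + (m ℕ.^ n) ≡ (+ m) ^ n
pos-^ m zero    = refl
pos-^ m (suc n) = trans (ℤ.pos-* m (m ℕ.^ n)) (cong (+ m *_) (pos-^ m n))

-- 2 b(M + 1, 2); the shift is needed since b(0, 2) does not fit the polynomial.
doubled-ball-2 : ℤ → ℤ → ℤ
doubled-ball-2 Q M = + 2 * Q + + 2 * M * (Q - + 1) + (Q - + 1) * (Q - + 1) * M * (M + + 1)
  + + 2 * M * (Q * Q * (Q - + 1))

-- 6 b(N, 3) for N ≥ 2, where 6 = 3! clears the denominators. The leading term stems from the
-- diagonal matrices with three nonzero entries, of which there are binomially many times (q - 1)³.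
sextupled-ball-3 : ℤ → ℤ → ℤ
sextupled-ball-3 Q N =
  (Q - + 1) * (Q - + 1) * (Q - + 1) * (N * N * N)
  + + 3 * ((Q - + 1) * (Q - + 1)) * (+ 2 * (Q * Q) - Q + + 2) * (N * N)
  + (Q - + 1) * (+ 6 * (Q * Q * Q * Q) - + 18 * (Q * Q * Q) + + 26 * (Q * Q) - + 7 * Q + + 11) * N
  + + 6 * (- (+ 2) * (Q * Q * Q * Q * Q) + + 4 * (Q * Q * Q * Q) - + 5 * (Q * Q * Q) + + 3 *
    (Q * Q) + + 1)

-- The ring solver does not unfold _^_ or definitions, so its goals are written out below.
doubled-ball-2-suc : ∀ Q M l₂ → + 2 * l₂ ≡ doubled-ball-2 Q M →
  + 2 * (l₂ + ((Q - + 1) * (+ 1 + (+ 1 + M) * (Q - + 1)) + Q ^ 2 * (Q - + 1) * + 1))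
  ≡ doubled-ball-2 Q (+ 1 + M)
doubled-ball-2-suc Q M l₂ eq = trans (ℤ.*-distribˡ-+ (+ 2) l₂ _) (trans (cong (_+ _) eq) (step Q M))
  where
  step : ∀ Q M →
    + 2 * Q + + 2 * M * (Q - + 1) + (Q - + 1) * (Q - + 1) * M * (M + + 1) + + 2 * M *
      (Q * Q * (Q - + 1))
      + + 2 * ((Q - + 1) * (+ 1 + (+ 1 + M) * (Q - + 1)) + Q * (Q * + 1) * (Q - + 1) * + 1)
    ≡ + 2 * Q + + 2 * (+ 1 + M) * (Q - + 1) + (Q - + 1) * (Q - + 1) * (+ 1 + M) * (+ 1 + M + + 1)
      + + 2 * (+ 1 + M) * (Q * Q * (Q - + 1))
  step = solve-∀

sextupled-ball-3-suc : ∀ Q M l₃ l₂ →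
  + 6 * l₃ ≡ sextupled-ball-3 Q (+ 2 + M) → + 2 * l₂ ≡ doubled-ball-2 Q (+ 1 + M) →
  + 6 * (l₃ + ((Q - + 1) * l₂ +
    (Q ^ 2 * (Q - + 1) * (+ 1 + (+ 1 + M) * (Q - + 1)) + Q ^ 4 * (Q - + 1) * + 1)))
  ≡ sextupled-ball-3 Q (+ 3 + M)
-- Writing 6 (Q - 1) l₂ as 3 (Q - 1) (2 l₂) lets the doubled formula for radius 2 be inserted
-- without division.
sextupled-ball-3-suc Q M l₃ l₂ eq₃ eq₂ = trans (regroup Q l₃ l₂ _)
  (trans (cong₂ (λ x y → x + (+ 3 * (Q - + 1) * y + _)) eq₃ eq₂) (step Q M))
  where
  regroup : ∀ Q l₃ l₂ x →
    + 6 * (l₃ + ((Q - + 1) * l₂ + x)) ≡ + 6 * l₃ + (+ 3 * (Q - + 1) * (+ 2 * l₂) + + 6 * x)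
  regroup = solve-∀
  step : ∀ Q M → let N = + 2 + M; N′ = + 3 + M; L = + 1 + M in
      (Q - + 1) * (Q - + 1) * (Q - + 1) * (N * N * N)
        + + 3 * ((Q - + 1) * (Q - + 1)) * (+ 2 * (Q * Q) - Q + + 2) * (N * N)
        + (Q - + 1) * (+ 6 * (Q * Q * Q * Q) - + 18 * (Q * Q * Q) + + 26 *
          (Q * Q) - + 7 * Q + + 11) * N
        + + 6 * (- (+ 2) * (Q * Q * Q * Q * Q) + + 4 * (Q * Q * Q * Q) - + 5 * (Q * Q * Q) + + 3 *
          (Q * Q) + + 1)
      + (+ 3 * (Q - + 1) * (+ 2 * Q + + 2 * L * (Q - + 1) + (Q - + 1) * (Q - + 1) * L * (L + + 1)
          + + 2 * L * (Q * Q * (Q - + 1)))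
        + + 6 * (Q * (Q * + 1) * (Q - + 1) * (+ 1 + L * (Q - + 1))
          + Q * (Q * (Q * (Q * + 1))) * (Q - + 1) * + 1))
    ≡
      (Q - + 1) * (Q - + 1) * (Q - + 1) * (N′ * N′ * N′)
        + + 3 * ((Q - + 1) * (Q - + 1)) * (+ 2 * (Q * Q) - Q + + 2) * (N′ * N′)
        + (Q - + 1) * (+ 6 * (Q * Q * Q * Q) - + 18 * (Q * Q * Q) + + 26 *
          (Q * Q) - + 7 * Q + + 11) * N′
        + + 6 * (- (+ 2) * (Q * Q * Q * Q * Q) + + 4 * (Q * Q * Q * Q) - + 5 * (Q * Q * Q) + + 3 *
          (Q * Q) + + 1)
  step = solve-∀

module BallSize {q : ℕ} (F : FiniteField q) where
  open FlagRank F using (Matrix)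
  open Balls F
    using ( nonzeros; 1+length-nonzeros; Parameters; parameters; extend₁; extend₂; extend₃
          ; ball; ball₁; ball₂; ball₃; length-ball-suc; length-step)

  private
    Q = + q

  size : ℕ → ℕ → ℤ
  size s n = + length (ball s n)

  length-nonzeros : + length nonzeros ≡ Q - + 1
  length-nonzeros = begin
    + length nonzeros                ≡⟨ expand (+ length nonzeros) ⟩
    + suc (length nonzeros) - + 1    ≡⟨ cong (λ m → + m - + 1) 1+length-nonzeros ⟩
    Q - + 1                          ∎
    where
    open ≡-Reasoning
    expand : ∀ x → x ≡ + 1 + x - + 1
    expand = solve-∀

  size-step : ∀ {k m n} (f : Parameters k → Matrix n n → Matrix m m) (Ms : List (Matrix n n)) Ns →
    + length (cartesianProductWith f (parameters k) Ms ++ Ns) ≡ Q ^ k *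
      (Q - + 1) * + length Ms + + length Ns
  size-step {k} f Ms Ns = begin
    + length (cartesianProductWith f (parameters k) Ms ++ Ns)
      ≡⟨ cong +_ (length-step f Ms Ns) ⟩
    + (q ℕ.^ k ℕ.* length nonzeros ℕ.* length Ms) + + length Ns
      ≡⟨ cong (_+ + length Ns) (trans (ℤ.pos-* (q ℕ.^ k ℕ.* length nonzeros) (length Ms))
           (cong (_* + length Ms) (trans (ℤ.pos-* (q ℕ.^ k) (length nonzeros))
             (cong₂ _*_ (pos-^ q k) length-nonzeros)))) ⟩
    Q ^ k * (Q - + 1) * + length Ms + + length Ns ∎
    where open ≡-Reasoning

  size-suc : ∀ s n → size s (suc n) ≡ size s n + + length (ball₁ s n)
  size-suc s n = cong +_ (length-ball-suc s n)

  size-0 : ∀ n → size 0 n ≡ + 1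
  size-0 zero    = refl
  size-0 (suc n) = trans (size-suc 0 n) (cong (_+ + 0) (size-0 n))

  size-1-suc : ∀ n → size 1 (1 ℕ.+ n) ≡ size 1 n + (Q - + 1) * size 0 n
  size-1-suc n = trans (size-suc 1 n)
    (cong (λ x → size 1 n + x)
      (trans (size-step extend₁ (ball 0 n) (ball₂ 0 n)) (tidy (Q - + 1) (size 0 n))))
    where
    tidy : ∀ p x → + 1 * p * x + + 0 ≡ p * x
    tidy = solve-∀

  size-2-suc : ∀ n → size 2 (2 ℕ.+ n) ≡
    size 2 (1 ℕ.+ n) + ((Q - + 1) * size 1 (1 ℕ.+ n) + Q ^ 2 * (Q - + 1) * size 0 n)
  size-2-suc n = trans (size-suc 2 (1 ℕ.+ n)) (cong (λ x → size 2 (1 ℕ.+ n) + x) (begin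
    + length (ball₁ 2 (1 ℕ.+ n))
      ≡⟨ size-step extend₁ (ball 1 (1 ℕ.+ n)) (ball₂ 1 (1 ℕ.+ n)) ⟩
    Q ^ 0 * (Q - + 1) * size 1 (1 ℕ.+ n) + + length (ball₂ 1 (1 ℕ.+ n))
      ≡⟨ cong (λ x → Q ^ 0 * (Q - + 1) * size 1 (1 ℕ.+ n) + x)
        (size-step extend₂ (ball 0 n) (ball₃ 0 n)) ⟩
    Q ^ 0 * (Q - + 1) * size 1 (1 ℕ.+ n) + (Q ^ 2 * (Q - + 1) * size 0 n + + 0)
      ≡⟨ tidy (Q - + 1) (size 1 (1 ℕ.+ n)) _ ⟩
    (Q - + 1) * size 1 (1 ℕ.+ n) + Q ^ 2 * (Q - + 1) * size 0 n ∎))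
    where
    open ≡-Reasoning
    tidy : ∀ p x y → + 1 * p * x + (y + + 0) ≡ p * x + y
    tidy = solve-∀

  size-3-suc : ∀ n → size 3 (3 ℕ.+ n) ≡ size 3 (2 ℕ.+ n) +
    ((Q - + 1) * size 2 (2 ℕ.+ n) +
      (Q ^ 2 * (Q - + 1) * size 1 (1 ℕ.+ n) + Q ^ 4 * (Q - + 1) * size 0 n))
  size-3-suc n = trans (size-suc 3 (2 ℕ.+ n)) (cong (λ x → size 3 (2 ℕ.+ n) + x) (begin
    + length (ball₁ 3 (2 ℕ.+ n))
      ≡⟨ size-step extend₁ (ball 2 (2 ℕ.+ n)) (ball₂ 2 (2 ℕ.+ n)) ⟩
    a + + length (ball₂ 2 (2 ℕ.+ n))
      ≡⟨ cong (λ x → a + x) (size-step extend₂ (ball 1 (1 ℕ.+ n)) (ball₃ 1 (1 ℕ.+ n))) ⟩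
    a + (b + + length (ball₃ 1 (1 ℕ.+ n)))
      -- `ball₃` is a product with nothing appended; the empty list gives it the shape that
      -- `size-step` expects.
      ≡⟨ cong (λ Ms → a + (b + + length Ms)) (List.++-identityʳ (ball₃ 1 (1 ℕ.+ n))) ⟨
    a + (b + + length (ball₃ 1 (1 ℕ.+ n) ++ List.[]))
      ≡⟨ cong (λ x → a + (b + x)) (size-step extend₃ (ball 0 n) List.[]) ⟩
    a + (b + (Q ^ 4 * (Q - + 1) * size 0 n + + 0))
      ≡⟨ tidy (Q - + 1) (size 2 (2 ℕ.+ n)) b _ ⟩
    (Q - + 1) * size 2 (2 ℕ.+ n) + (b + Q ^ 4 * (Q - + 1) * size 0 n) ∎))
    where
    open ≡-Reasoning
    a = Q ^ 0 * (Q - + 1) * size 2 (2 ℕ.+ n)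
    b = Q ^ 2 * (Q - + 1) * size 1 (1 ℕ.+ n)
    tidy : ∀ p x y z → + 1 * p * x + (y + (z + + 0)) ≡ p * x + (y + z)
    tidy = solve-∀

  size-1 : ∀ n → size 1 n ≡ + 1 + + n * (Q - + 1)
  size-1 zero    = refl
  size-1 (suc n) = trans (size-1-suc n)
    (trans (cong₂ (λ x y → x + (Q - + 1) * y) (size-1 n) (size-0 n)) (step (Q - + 1) (+ n)))
    where
    step : ∀ p N → + 1 + N * p + p * + 1 ≡ + 1 + (+ 1 + N) * p
    step = solve-∀

  size-2 : ∀ m → + 2 * size 2 (1 ℕ.+ m) ≡ doubled-ball-2 Q (+ m)
  size-2 zero    = trans (cong (+ 2 *_) (trans (size-suc 2 0) (cong (λ x → + 1 + x)
    (size-step extend₁ (ball 1 0) (ball₂ 1 0))))) (base Q)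
    where
    base : ∀ Q → + 2 * (+ 1 + (+ 1 * (Q - + 1) * + 1 + + 0)) ≡
      + 2 * Q + + 2 * + 0 * (Q - + 1) + (Q - + 1) * (Q - + 1) * + 0 * (+ 0 + + 1) + + 2 * + 0 *
        (Q * Q * (Q - + 1))
    base = solve-∀
  size-2 (suc m) = trans
    (cong (+ 2 *_) (trans (size-2-suc m)
      (cong₂ (λ x y → size 2 (1 ℕ.+ m) + ((Q - + 1) * x + Q ^ 2 * (Q - + 1) * y))
      (size-1 (1 ℕ.+ m)) (size-0 m))))
    (doubled-ball-2-suc Q (+ m) _ (size-2 m))

  -- The recursion with all four of its terms reaches three sizes back and so starts at size 3; size
  -- 2 is the base and is computed directly.
  size-3 : ∀ m → + 6 * size 3 (2 ℕ.+ m) ≡ sextupled-ball-3 Q (+ (2 ℕ.+ m))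
  size-3 zero    = trans (cong (+ 6 *_) size-3-2) (base Q)
    where
    size-3-1 : size 3 1 ≡ + 1 + (+ 1 * (Q - + 1) * + 1 + + 0)
    size-3-1 = trans (size-suc 3 0)
      (cong (λ x → + 1 + x) (size-step extend₁ (ball 2 0) (ball₂ 2 0)))
    size-2-1 : size 2 1 ≡ + 1 + (+ 1 * (Q - + 1) * + 1 + + 0)
    size-2-1 = trans (size-suc 2 0)
      (cong (λ x → + 1 + x) (size-step extend₁ (ball 1 0) (ball₂ 1 0)))
    size-3-2 : size 3 2 ≡ (+ 1 + (+ 1 * (Q - + 1) * + 1 + + 0)) +
      (+ 1 * (Q - + 1) * (+ 1 + (+ 1 * (Q - + 1) * + 1 + + 0)) + (Q ^ 2 * (Q - + 1) * + 1 + + 0))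
    size-3-2 = trans (size-suc 3 1) (cong₂ _+_ size-3-1
      (trans (size-step extend₁ (ball 2 1) (ball₂ 2 1))
        (cong₂ (λ x y → Q ^ 0 * (Q - + 1) * x + y) size-2-1
          (size-step extend₂ (ball 1 0) (ball₃ 1 0)))))
    base : ∀ Q → + 6 * ((+ 1 + (+ 1 * (Q - + 1) * + 1 + + 0)) +
      (+ 1 * (Q - + 1) * (+ 1 + (+ 1 * (Q - + 1) * + 1 + + 0)) +
        (Q * (Q * + 1) * (Q - + 1) * + 1 + + 0))) ≡
      (Q - + 1) * (Q - + 1) * (Q - + 1) * (+ 2 * + 2 * + 2)
      + + 3 * ((Q - + 1) * (Q - + 1)) * (+ 2 * (Q * Q) - Q + + 2) * (+ 2 * + 2)
      + (Q - + 1) * (+ 6 * (Q * Q * Q * Q) - + 18 * (Q * Q * Q) + + 26 *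
        (Q * Q) - + 7 * Q + + 11) * + 2
      + + 6 * (- (+ 2) * (Q * Q * Q * Q * Q) + + 4 * (Q * Q * Q * Q) - + 5 * (Q * Q * Q) + + 3 *
        (Q * Q) + + 1)
    base = solve-∀
  size-3 (suc m) = trans
    (cong (+ 6 *_) (trans (size-3-suc m) (cong₂ (λ x y → size 3 (2 ℕ.+ m) +
        ((Q - + 1) * size 2 (2 ℕ.+ m) + (Q ^ 2 * (Q - + 1) * x + Q ^ 4 * (Q - + 1) * y)))
      (size-1 (1 ℕ.+ m)) (size-0 m))))
    (sextupled-ball-3-suc Q (+ m) _ _ (size-3 m) (size-2 (1 ℕ.+ m)))

-- `X` takes the place of q^α, whose exponent is a variable, so that what remains is a polynomial
-- identity.
perfect-polynomial : ℤ → ℤ → ℤ → ℤ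
perfect-polynomial Q N X =
  (Q - + 1) ^ 3 * N ^ 3
  + + 3 * (Q - + 1) ^ 2 * (+ 2 * Q ^ 2 - Q + + 2) * N ^ 2
  + (Q - + 1) * (+ 6 * Q ^ 4 - + 18 * Q ^ 3 + + 26 * Q ^ 2 - + 7 * Q + + 11) * N
  + + 6 * (- (+ 2) * Q ^ 5 + + 4 * Q ^ 4 - + 5 * Q ^ 3 + + 3 * Q ^ 2 + + 1 - X)

perfect-polynomial≡ : ∀ Q N X → perfect-polynomial Q N X ≡ sextupled-ball-3 Q N - + 6 * X
perfect-polynomial≡ = expand
  where
  expand : ∀ Q N X →
    (Q - + 1) * ((Q - + 1) * ((Q - + 1) * + 1)) * (N * (N * (N * + 1)))
    + + 3 * ((Q - + 1) * ((Q - + 1) * + 1)) * (+ 2 * (Q * (Q * + 1)) - Q + + 2) * (N * (N * + 1))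
    + (Q - + 1) * (+ 6 * (Q * (Q * (Q * (Q * + 1)))) - + 18 * (Q * (Q * (Q * + 1))) + + 26 *
      (Q * (Q * + 1)) - + 7 * Q + + 11) * N
    + + 6 * (- (+ 2) * (Q * (Q * (Q * (Q * (Q * + 1))))) + + 4 *
      (Q * (Q * (Q * (Q * + 1)))) - + 5 * (Q * (Q * (Q * + 1)))
      + + 3 * (Q * (Q * + 1)) + + 1 - X)
    ≡
    (Q - + 1) * (Q - + 1) * (Q - + 1) * (N * N * N)
    + + 3 * ((Q - + 1) * (Q - + 1)) * (+ 2 * (Q * Q) - Q + + 2) * (N * N)
    + (Q - + 1) * (+ 6 * (Q * Q * Q * Q) - + 18 * (Q * Q * Q) + + 26 * (Q * Q) - + 7 * Q + + 11) * N
    + + 6 * (- (+ 2) * (Q * Q * Q * Q * Q) + + 4 * (Q * Q * Q * Q) - + 5 * (Q * Q * Q) + + 3 *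
      (Q * Q) + + 1)
    - + 6 * X
  expand = solve-∀

-- Perfect codes

module Perfect {q : ℕ} (F : FiniteField q) where
  open FlagRank F
  open Balls F using (b≡length-ball; cardinality≡q^k)
  open BallSize F
  open LinearCode

  b≡q^α⇔polynomial≡0 : ∀ n → 2 ℕ.≤ n → ∀ α →
    b n 3 ≡ q ℕ.^ α ⇔ perfect-polynomial (+ q) (+ n) ((+ q) ^ α) ≡ + 0
  b≡q^α⇔polynomial≡0 n 2≤n α = mk⇔
    (λ eq → trans polynomial
      (trans (cong (λ x → + 6 * x - + 6 * (+ q) ^ α) (trans (cong +_ eq) (pos-^ q α)))
      (ℤ.+-inverseʳ (+ 6 * (+ q) ^ α))))
    (λ eq → ℤ.+-injective
      (trans (ℤ.*-cancelˡ-≡ (+ 6) _ _ (ℤ.i-j≡0⇒i≡j _ _ (trans (sym polynomial) eq)))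
      (sym (pos-^ q α))))
    where
    six-b : ∀ {n} → 2 ℕ.≤ n → + 6 * + b n 3 ≡ sextupled-ball-3 (+ q) (+ n)
    six-b {suc (suc m)} _ =
      trans (cong (λ x → + 6 * + x) (b≡length-ball (2 ℕ.+ m) 3 ℕ.≤-refl)) (size-3 m)
    six-b {suc zero} (s≤s ())
    polynomial : perfect-polynomial (+ q) (+ n) ((+ q) ^ α) ≡ + 6 * + b n 3 - + 6 * (+ q) ^ α
    polynomial = trans (perfect-polynomial≡ (+ q) (+ n) ((+ q) ^ α))
      (cong (_- + 6 * (+ q) ^ α) (sym (six-b 2≤n)))

  module _ {n : ℕ} (C : LinearCode n) (minimum : IsMinimumDistance C 7) where

    -- `IsPerfect` brings its own distance, which has to be identified with 7 before its radius is
    -- known to be 3.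
    minimum-unique : ∀ {δ} → IsMinimumDistance C δ → δ ≡ 7
    minimum-unique ((M , M∈ , M≢0 , frM≡δ) , δ≤) = ℕ.≤-antisym
      (let M₇ , M₇∈ , M₇≢0 , frM₇≡7 = proj₁ minimum in ℕ.≤-trans (δ≤ M₇ M₇∈ M₇≢0)
        (ℕ.≤-reflexive frM₇≡7))
      (ℕ.≤-trans (proj₂ minimum M M∈ M≢0) (ℕ.≤-reflexive frM≡δ))

    -- The code has q^k elements and the whole space has q^(k + α), so the positive factor q^k
    -- cancels from the equation for perfection.
    perfect⇔b≡q^α : ∀ α → HasCodimension C α → IsPerfect C ⇔ b n 3 ≡ q ℕ.^ α
    perfect⇔b≡q^α α (k , (B , members , independent , spanning) , k+α≡) = mk⇔
      (λ { (δ , minδ , eq) → ℕ.*-cancelˡ-≡ _ _ (q ℕ.^ k) {{ℕ.m^n≢0 q k {{q≢0}}}}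
        (trans (cong₂ ℕ._*_ (sym ∣C∣)
          (cong (λ δ → b n ((δ ℕ.∸ 1) ℕ./ 2)) (sym (minimum-unique minδ))))
          (trans eq (sym volume))) })
      (λ eq → 7 , minimum , trans (cong₂ ℕ._*_ ∣C∣ eq) volume)
      where
      q≢0 : ℕ.NonZero q
      q≢0 = ℕ.>-nonZero (ℕ.<-trans (s≤s z≤n) (1<order F))
      ∣C∣ : cardinality (member? C) ≡ q ℕ.^ k
      ∣C∣ = cardinality≡q^k C B members independent spanning
      volume : q ℕ.^ k ℕ.* q ℕ.^ α ≡ q ℕ.^ ((n ℕ.* (n ℕ.+ 1)) ℕ./ 2)
      volume = trans (sym (ℕ.^-distribˡ-+-* q k α)) (cong (q ℕ.^_) k+α≡)

theorem5p14 :
    ∀ (n : ℕ) → 1 ℕ.≤ n →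
    ∀ (q : ℕ) → IsPrimePower q →
    ∀ (F : FiniteField q) → let open FlagRank F in
    ∀ (C : LinearCode n) → IsMinimumDistance C 7 →
    ∀ (α : ℕ) → HasCodimension C α →
    let Q = + q
        N = + n
    in
    (IsPerfect C ⇔
      (3 ℕ.≤ n ×
        (Q - + 1) ^ 3 * N ^ 3
        + + 3 * (Q - + 1) ^ 2 * (+ 2 * Q ^ 2 - Q + + 2) * N ^ 2
        + (Q - + 1) * (+ 6 * Q ^ 4 - + 18 * Q ^ 3 + + 26 * Q ^ 2 - + 7 * Q + + 11) * N
        + + 6 * (- (+ 2) * Q ^ 5 + + 4 * Q ^ 4 - + 5 * Q ^ 3 + + 3 * Q ^ 2 + + 1 - Q ^ α)
        ≡ + 0))
    × 10 ℕ.≤ α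
theorem5p14 n _ q _ F C minimum α codim =
  -- The bound on `n` is read off from the distance, and the equation from the ball size.
  mk⇔ (λ perfect → ℕ.<⇒≤ 4≤ , Equivalence.to polynomial (Equivalence.to ball perfect))
      (λ { (_ , eq) → Equivalence.from ball (Equivalence.from polynomial eq) })
  , codimension≥10 C distance α codim
  where
  open Balls F using (distance7; 4≤n; codimension≥10)
  open Perfect F
  distance = distance7 C minimum
  4≤ : 4 ℕ.≤ n
  4≤ = 4≤n C distance
  ball = perfect⇔b≡q^α C minimum α codim
  polynomial = b≡q^α⇔polynomial≡0 n (ℕ.<⇒≤ (ℕ.<⇒≤ 4≤)) α
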